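{- Let $U\in\mathcal{P}(n,d)$ and let $L^{tr}=\mathbf{e}^d\mathbf{n}^{n-d}\in\mathcal{P}(n,d)$. Let $\Lambda=\Lambda_{M[U,L^{tr}]}$. Then $\operatorname{st}_{L^{tr}}(C)=\Lambda(E(C))$ for all $C\in\mathcal{P}[U,L^{tr}]$. In particular, \[ \mathcal{S}_{\mathsf{lex}}(M[U,L^{tr}])=\{\operatorname{st}_{L^{tr}}(C): C\in\mathcal{P}[U,L^{tr}]\}. \]
   Context: $\mathcal{P}(n,d)$ is the set of words of length $n$ in letters $\mathbf{e}$ (east) and $\mathbf{n}$ (north) with exactly $d$ letters $\mathbf{e}$ (lattice paths from $(0,0)$ to $(d,n-d)$). For $C\in\mathcal{P}(n,d)$, $E(C)\subseteq[n]$ is the set of positions of its $\mathbf{e}$'s. For $U,L\in\mathcal{P}(n,d)$, $U$ is weakly above $L$ if every prefix of $L$ contains at least as many $\mathbf{e}$'s as the prefix of $U$ of the same length; $\mathcal{P}[U,L]$ is the set of $C\in\mathcal{P}(n,d)$ weakly below $U$ and weakly above $L$. The lattice path matroid $M[U,L]$ is the matroid on $[n]$ whose bases are $\{E(C):C\in\mathcal{P}[U,L]\}$. Statistic: for $C\in\mathcal{P}(n,d)$, scan positions $i=1,\dots,n$ from left to right and mark position $i$ with $C_i=\mathbf{e}$ if the number of $\mathbf{n}$'s at positions $<i$ equals the number of unmarked $\mathbf{e}$'s at positions $<i$; $\operatorname{st}_{L^{tr}}(C)\subseteq E(C)$ is the set of positions of unmarked $\mathbf{e}$'s. Standard complex: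 for a matroid $M$ on finite $E\subseteq\mathbb{N}$ with bases $\mathcal{B}(M)$, $\mathcal{S}_{\mathsf{lex}}(M)=\{\tau\subseteq E:\prod_{i\in\tau}x_i\notin\mathrm{in}_{\mathsf{lex}}(I(V_M))\}$ where $V_M=\{\mathbf{e}_B:B\in\mathcal{B}(M)\}\subseteq\{0,1\}^E$, $I(V_M)$ is its vanishing ideal, and $\mathsf{lex}$ is the lexicographic order with $x_i\succ x_j$ for $i<j$. $\{\Lambda_M\}$ is the unique family (over all matroids with finite groundset in $\mathbb{N}$) of bijections $\Lambda_M:\mathcal{B}(M)\to\mathcal{S}_{\mathsf{lex}}(M)$ such that $\Lambda_M(B)\subseteq B$, and for nonempty groundset with largest element $m$: $\Lambda_M(B)=\Lambda_{M\setminus m}(B)$ if $m\notin B$, and $\Lambda_M(B)\setminus\{m\}=\Lambda_{M/m}(B\setminus\{m\})$ if $m\in B$. -}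

module Defs where

open import Data.Nat using (ℕ; zero; suc; _≤_; _<_; _∸_; _≟_)
open import Data.Rational using (ℚ; 0ℚ; 1ℚ; _+_; _*_)
open import Data.List using (List; []; _∷_; _++_; [_]; length; take; filter; replicate; applyUpTo)
open import Data.List.Relation.Unary.All using (All)
open import Data.List.Relation.Unary.Linked using (Linked)
open import Data.List.Membership.Propositional using (_∈_; _∉_)
open import Data.List.Membership.DecPropositional _≟_ using (_∈?_)
open import Data.List.Relation.Binary.Subset.Propositional using (_⊆_)
open import Data.Vec using (Vec; []; _∷_)
open import Data.Vec.Relation.Binary.Pointwise.Inductive using (Pointwise)
open import Data.Product using (Σ; Σ-syntax; _×_; _,_; proj₁; proj₂)
open import Data.Sum using (_⊎_)
open import Data.Empty using (⊥)
open import Relation.Nullary using (¬_; ¬?; yes; no)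
open import Relation.Binary.PropositionalEquality using (_≡_; _≢_)
open import Function.Bundles using (_⇔_)

-- Finite subsets of ℕ are represented canonically as strictly
-- increasing lists.

Strict : List ℕ → Set
Strict = Linked _<_

remove : ℕ → List ℕ → List ℕ
remove m = filter (λ x → ¬? (x ≟ m))

range : ℕ → List ℕ
range n = applyUpTo suc n

BasisPred : Set₁
BasisPred = List ℕ → Set

record IsMatroid (E : List ℕ) (P : BasisPred) : Set where
  field
    ground-strict : Strict E
    basis-strict  : ∀ B → P B → Strict B
    basis-sub     : ∀ B → P B → B ⊆ E
    basis-exists  : Σ[ B ∈ List ℕ ] P B
    exchange      : ∀ B₁ B₂ → P B₁ → P B₂ → ∀ x → x ∈ B₁ → x ∉ B₂ →
                    Σ[ y ∈ ℕ ] (y ∈ B₂ × y ∉ B₁ ×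
                      Σ[ B₃ ∈ List ℕ ] (P B₃ ×
                        (∀ z → (z ∈ B₃) ⇔ ((z ∈ B₁ × z ≢ x) ⊎ z ≡ y))))

IsLoop : BasisPred → ℕ → Set
IsLoop P m = ∀ B → P B → m ∉ B

IsColoop : BasisPred → ℕ → Set
IsColoop P m = ∀ B → P B → m ∈ B

Del : BasisPred → ℕ → BasisPred
Del P m B = (¬ IsColoop P m × P B × m ∉ B)
          ⊎ (IsColoop P m × Σ[ B₀ ∈ List ℕ ] (P B₀ × B ≡ remove m B₀))

Con : BasisPred → ℕ → BasisPred
Con P m B = (IsLoop P m × P B)
          ⊎ (¬ IsLoop P m × Σ[ B₀ ∈ List ℕ ] (P B₀ × m ∈ B₀ × B ≡ remove m B₀))

-- Polynomials over ℚ in the variables x_i (i ∈ E).  A monomial is an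
-- exponent vector indexed by the positions of E (in increasing order).

Mon : List ℕ → Set
Mon E = Vec ℕ (length E)

-- lexicographic order with x_i ≻ x_j for i < j: compare the exponent of
-- the smallest variable first.
_<lex_ : ∀ {k} → Vec ℕ k → Vec ℕ k → Set
[]       <lex []       = ⊥
(a ∷ as) <lex (b ∷ bs) = a < b ⊎ (a ≡ b × as <lex bs)

_∣ₘ_ : ∀ {k} → Vec ℕ k → Vec ℕ k → Set
a ∣ₘ b = Pointwise _≤_ a b

sqfree : (E : List ℕ) → List ℕ → Mon E
sqfree []      τ = []
sqfree (x ∷ E) τ with x ∈? τ
... | yes _ = 1 ∷ sqfree E τ
... | no  _ = 0 ∷ sqfree E τ

powℚ : ℚ → ℕ → ℚ
powℚ q zero    = 1ℚ
powℚ q (suc a) = q * powℚ q a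

evalMon : (E : List ℕ) → List ℕ → Mon E → ℚ
evalMon []      B []       = 1ℚ
evalMon (x ∷ E) B (a ∷ as) with x ∈? B
... | yes _ = powℚ 1ℚ a * evalMon E B as
... | no  _ = powℚ 0ℚ a * evalMon E B as

evalPoly : (E : List ℕ) → List ℕ → List (ℚ × Mon E) → ℚ
evalPoly E B []             = 0ℚ
evalPoly E B ((c , μ) ∷ ts) = c * evalMon E B μ + evalPoly E B ts

Vanishes : (E : List ℕ) → BasisPred → List (ℚ × Mon E) → Set
Vanishes E P f = ∀ B → P B → evalPoly E B f ≡ 0ℚ

-- x^τ ∈ in_lex(I(V_M)): x^τ is divisible by the lex-leading monomial μ of
-- some nonzero f ∈ I(V_M).  Such f is written as  c·x^μ + (terms with
-- monomials lex-smaller than μ), c ≠ 0.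
InInitial : (E : List ℕ) → BasisPred → List ℕ → Set
InInitial E P τ =
  Σ[ c ∈ ℚ ] Σ[ μ ∈ Mon E ] Σ[ ts ∈ List (ℚ × Mon E) ]
    (c ≢ 0ℚ × All (λ t → proj₂ t <lex μ) ts ×
     Vanishes E P ((c , μ) ∷ ts) × μ ∣ₘ sqfree E τ)

Slex : (E : List ℕ) → BasisPred → List ℕ → Set
Slex E P τ = Strict τ × τ ⊆ E × ¬ InInitial E P τ

-- The family {Λ_M}.  Λ E P B is Λ_M(B) for the matroid M with groundset
-- E and basis predicate P.

LambdaFam : Set₁
LambdaFam = List ℕ → BasisPred → List ℕ → List ℕ

IsLambdaFamily : LambdaFam → Set₁
IsLambdaFamily Λ = ∀ E P → IsMatroid E P →
  (∀ B → P B → Λ E P B ⊆ B) ×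
  (∀ B → P B → Slex E P (Λ E P B)) ×
  (∀ B B′ → P B → P B′ → Λ E P B ≡ Λ E P B′ → B ≡ B′) ×
  (∀ τ → Slex E P τ → Σ[ B ∈ List ℕ ] (P B × Λ E P B ≡ τ)) ×
  -- recursion on the largest element m of the groundset
  (∀ E′ m → E ≡ E′ ++ [ m ] → ∀ B → P B →
     (m ∉ B → Λ E P B ≡ Λ E′ (Del P m) B) ×
     (m ∈ B → remove m (Λ E P B) ≡ Λ E′ (Con P m) (remove m B)))

data Step : Set where
  𝐞 𝐧 : Step

countE : List Step → ℕ
countE []       = 0
countE (𝐞 ∷ s) = suc (countE s)
countE (𝐧 ∷ s) = countE s

InP : ℕ → ℕ → List Step → Set
InP n d C = length C ≡ n × countE C ≡ d

WeaklyAbove : List Step → List Step → Set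
WeaklyAbove U L = ∀ k → countE (take k U) ≤ countE (take k L)

InPUL : ℕ → ℕ → List Step → List Step → List Step → Set
InPUL n d U L C = InP n d C × WeaklyAbove U C × WeaklyAbove C L

posE : ℕ → List Step → List ℕ
posE i []       = []
posE i (𝐞 ∷ s) = i ∷ posE (suc i) s
posE i (𝐧 ∷ s) = posE (suc i) s

EC : List Step → List ℕ
EC = posE 1

LPM : ℕ → ℕ → List Step → List Step → BasisPred
LPM n d U L B = Σ[ C ∈ List Step ] (InPUL n d U L C × EC C ≡ B)

Ltr : ℕ → ℕ → List Step
Ltr n d = replicate d 𝐞 ++ replicate (n ∸ d) 𝐧

-- st_{L^tr}: position i, #n's before i, #unmarked e's before i
stGo : ℕ → ℕ → ℕ → List Step → List ℕ
stGo i nn ue []       = []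
stGo i nn ue (𝐧 ∷ s) = stGo (suc i) (suc nn) ue s
stGo i nn ue (𝐞 ∷ s) with nn ≟ ue
... | yes _ = stGo (suc i) nn ue s
... | no  _ = i ∷ stGo (suc i) nn (suc ue) s

st : List Step → List ℕ
st = stGo 1 0 0

-- Let x_m be the smallest variable. For τ ∌ m, the monomial x^τ is standard for a point set V iff
-- it is standard for one of the slices V ∩ {x_m = 0}, V ∩ {x_m = 1}, and x^τ x_m is standard for V
-- iff x^τ is standard for both. Slicing the bases of M[U,L^tr] at the last position gives paths
-- subject to the same bound on prefixes, and the sets st(C) obey the same recursion: a path C with
-- an unmatched 𝐧 has the same st as the path obtained by turning the first such 𝐧 into an 𝐞. This
-- determines S_lex. For Λ, the recursion gives Λ(E(C)) up to the last position m, and whether m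
-- belongs to Λ(E(C)) is decided by injectivity of Λ and the description of S_lex.

{-# OPTIONS --safe #-}
module Submission where

open import Defs
open import Data.Nat using (ℕ)
open import Data.List using (List)
open import Data.Product using (Σ-syntax; _×_)
open import Relation.Binary.PropositionalEquality using (_≡_)
open import Function.Bundles using (_⇔_)

open import Data.Nat using (zero; suc; pred; _≤_; _<_; _≤?_; z≤n; s≤s)
import Data.Nat as ℕ
import Data.Nat.Properties as ℕ
open import Data.Rational using (ℚ; 0ℚ; 1ℚ)
import Data.Rational as ℚ
import Data.Rational.Properties as ℚ
open import Data.Rational.Solver using (module +-*-Solver)
open import Data.List using ([]; _∷_; _++_; [_]; map; length; take; replicate)
import Data.List.Properties as List
open import Data.List.Reverse using (Reverse; []; _∶_∶ʳ_; reverseView)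
open import Data.List.Membership.Propositional using (_∈_; _∉_)
open import Data.List.Membership.Propositional.Properties using (∈-++⁺ˡ; ∈-++⁺ʳ; ∈-++⁻; ∈-applyUpTo⁻)
open import Data.List.Membership.DecPropositional ℕ._≟_ using (_∈?_)
open import Data.List.Relation.Binary.Subset.Propositional using (_⊆_)
open import Data.List.Relation.Binary.Subset.Propositional.Properties using (⊆[]⇒≡[])
open import Data.List.Relation.Unary.Any using (here; there)
open import Data.List.Relation.Unary.All as All using (All; []; _∷_)
import Data.List.Relation.Unary.All.Properties as All
open import Data.List.Relation.Unary.AllPairs using ([]; _∷_)
import Data.List.Relation.Unary.AllPairs.Properties as AllPairs
open import Data.List.Relation.Unary.Linked using ([]; [-]; _∷_)
open import Data.List.Relation.Unary.Linked.Properties using (Linked⇒AllPairs; AllPairs⇒Linked)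
open import Data.Vec using (Vec; []; _∷_; zipWith)
open import Data.Vec.Relation.Binary.Pointwise.Inductive using ([]; _∷_)
open import Data.Product using (∃-syntax; _,_; proj₁; proj₂)
open import Data.Sum using (_⊎_; inj₁; inj₂; [_,_]′)
open import Data.Empty using (⊥)
open import Relation.Nullary using (¬_; ¬?; yes; no; contradiction; toSum)
open import Relation.Binary.PropositionalEquality
  using (_≢_; refl; sym; trans; cong; cong₂; subst; module ≡-Reasoning)
open import Function.Base using (_∘_)
open import Function.Bundles using (mk⇔; Equivalence)
open Equivalence using (to; from)

-- Standardness is a negation, so it cannot be split into cases constructively. The proof instead
-- builds, for every `τ`, either a polynomial witnessing `InInitial` or a word whose unmarked set is
-- `τ`; that a word excludes a polynomial is a separate induction. Both rest on one numerical fact.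
-- The number of 𝐞's, the height and the size of the unmarked set add up to the length, so among
-- words of a given length the first and the last determine the height, and the height tells whether
-- a further 𝐞 is marked. A set that occurs in both slices comes from words whose numbers of 𝐞's
-- differ by one; their heights then differ by one too, which forces an 𝐞 appended to the word with
-- fewer 𝐞's to be unmarked. The clauses defining a family Λ apply only to matroids, so basis
-- exchange has to be proved for every path family that the recursion meets, not only for M[U,L^tr].

private variable
  m n : ℕ
  E B B′ τ τ′ : List ℕ
  P P′ : BasisPred

-- Initial ideals and the last variable

module _ where

  open import Data.Rational using (_+_; _*_; -_; 1/_; ≢-nonZero)
  open +-*-Solver using (solve; con; _:+_; _:*_; :-_; _:=_)

  -- Defined by recursion on `E` because `length (E ++ [ m ])` does not reduce to a successor.
  snocMon : ∀ E {m} → Mon E → ℕ → Mon (E ++ [ m ])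
  snocMon []      []      a = a ∷ []
  snocMon (x ∷ E) (v ∷ ν) a = v ∷ snocMon E ν a

  unsnocMon : ∀ E (μ : Mon (E ++ [ m ])) → ∃[ ν ] ∃[ a ] μ ≡ snocMon E ν a
  unsnocMon []      (a ∷ []) = [] , a , refl
  unsnocMon (x ∷ E) (v ∷ μ)  with unsnocMon E μ
  ... | ν , a , refl = v ∷ ν , a , refl

  <lex-snoc⁻ : ∀ E {m} {ν ν′ : Mon E} {a a′} → snocMon E {m} ν a <lex snocMon E ν′ a′ →
               ν <lex ν′ ⊎ (ν ≡ ν′ × a < a′)
  <lex-snoc⁻ []      {ν = []}    {[]}      (inj₁ lt)         = inj₂ (refl , lt)
  <lex-snoc⁻ (x ∷ E) {ν = _ ∷ _} {_ ∷ _}   (inj₁ lt)         = inj₁ (inj₁ lt)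
  <lex-snoc⁻ (x ∷ E) {ν = _ ∷ _} {_ ∷ _}   (inj₂ (refl , lt)) with <lex-snoc⁻ E lt
  ... | inj₁ lt′          = inj₁ (inj₂ (refl , lt′))
  ... | inj₂ (refl , lt′) = inj₂ (refl , lt′)

  <lex-snoc-init : ∀ E {m} {ν ν′ : Mon E} {a a′} → ν <lex ν′ → snocMon E {m} ν a <lex snocMon E ν′ a′
  <lex-snoc-init []      {ν = []}    {[]}    ()
  <lex-snoc-init (x ∷ E) {ν = _ ∷ _} {_ ∷ _} (inj₁ lt)         = inj₁ lt
  <lex-snoc-init (x ∷ E) {ν = _ ∷ _} {_ ∷ _} (inj₂ (eq , lt)) = inj₂ (eq , <lex-snoc-init E lt)

  <lex-snoc-last : ∀ E {m} (ν : Mon E) {a a′} → a < a′ → snocMon E {m} ν a <lex snocMon E ν a′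
  <lex-snoc-last []      []      lt = inj₁ lt
  <lex-snoc-last (x ∷ E) (_ ∷ ν) lt = inj₂ (refl , <lex-snoc-last E ν lt)

  ∣ₘ-snoc⁻ : ∀ E {m} {ν ν′ : Mon E} {a a′} → snocMon E {m} ν a ∣ₘ snocMon E ν′ a′ →
             ν ∣ₘ ν′ × a ≤ a′
  ∣ₘ-snoc⁻ []      {ν = []}    {[]}    (le ∷ []) = [] , le
  ∣ₘ-snoc⁻ (x ∷ E) {ν = _ ∷ _} {_ ∷ _} (le ∷ p) with ∣ₘ-snoc⁻ E p
  ... | q , le′ = le ∷ q , le′

  sqfree-snoc-∈ : ∀ E → m ∈ τ → sqfree (E ++ [ m ]) τ ≡ snocMon E (sqfree E τ) 1
  sqfree-snoc-∈ {m} {τ} [] m∈τ with m ∈? τ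
  ... | yes _  = refl
  ... | no m∉τ = contradiction m∈τ m∉τ
  sqfree-snoc-∈ {m} {τ} (x ∷ E) m∈τ with x ∈? τ
  ... | yes _ = cong (1 ∷_) (sqfree-snoc-∈ E m∈τ)
  ... | no  _ = cong (0 ∷_) (sqfree-snoc-∈ E m∈τ)

  sqfree-snoc-∉ : ∀ E → m ∉ τ → sqfree (E ++ [ m ]) τ ≡ snocMon E (sqfree E τ) 0
  sqfree-snoc-∉ {m} {τ} [] m∉τ with m ∈? τ
  ... | yes m∈τ = contradiction m∈τ m∉τ
  ... | no _    = refl
  sqfree-snoc-∉ {m} {τ} (x ∷ E) m∉τ with x ∈? τ
  ... | yes _ = cong (1 ∷_) (sqfree-snoc-∉ E m∉τ)
  ... | no  _ = cong (0 ∷_) (sqfree-snoc-∉ E m∉τ)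

  -- Points and squarefree monomials matter only through membership of elements of `E`. A contracted
  -- basis and the same list with the last position appended are thus the same point over the
  -- smaller ground set.
  AgreeOn : List ℕ → List ℕ → List ℕ → Set
  AgreeOn E B B′ = ∀ {x} → x ∈ E → x ∈ B ⇔ x ∈ B′

  agree-refl : AgreeOn E B B
  agree-refl _ = mk⇔ (λ z → z) (λ z → z)

  agree-sym : ∀ {E xs ys} → AgreeOn E xs ys → AgreeOn E ys xs
  agree-sym ag x∈ = mk⇔ (from (ag x∈)) (to (ag x∈))

  sqfree-cong : ∀ E → AgreeOn E τ τ′ → sqfree E τ ≡ sqfree E τ′
  sqfree-cong [] _ = refl
  sqfree-cong {τ} {τ′} (x ∷ E) ag with x ∈? τ | x ∈? τ′
  ... | yes _ | yes _ = cong (1 ∷_) (sqfree-cong E (ag ∘ there))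
  ... | no  _ | no  _ = cong (0 ∷_) (sqfree-cong E (ag ∘ there))
  ... | yes p | no ¬p = contradiction (to (ag (here refl)) p) ¬p
  ... | no ¬p | yes p = contradiction (from (ag (here refl)) p) ¬p

  evalMon-cong : ∀ E → AgreeOn E B B′ → (μ : Mon E) → evalMon E B μ ≡ evalMon E B′ μ
  evalMon-cong [] _ [] = refl
  evalMon-cong {B} {B′} (x ∷ E) ag (a ∷ μ) with x ∈? B | x ∈? B′
  ... | yes _ | yes _ = cong (powℚ 1ℚ a *_) (evalMon-cong E (ag ∘ there) μ)
  ... | no  _ | no  _ = cong (powℚ 0ℚ a *_) (evalMon-cong E (ag ∘ there) μ)
  ... | yes p | no ¬p = contradiction (to (ag (here refl)) p) ¬p
  ... | no ¬p | yes p = contradiction (from (ag (here refl)) p) ¬p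

  evalPoly-cong : ∀ E → AgreeOn E B B′ → ∀ f → evalPoly E B f ≡ evalPoly E B′ f
  evalPoly-cong E ag []            = refl
  evalPoly-cong E ag ((c , μ) ∷ f) =
    cong₂ (λ u v → c * u + v) (evalMon-cong E ag μ) (evalPoly-cong E ag f)

  -- Every point of `P′` is, over `E`, a point of `P`, so a polynomial vanishing on `P` vanishes on
  -- `P′`: fewer points give a larger ideal.
  InInitial-transfer : ∀ E → (∀ B′ → P′ B′ → ∃[ B ] (P B × AgreeOn E B B′)) → AgreeOn E τ τ′ →
                       InInitial E P τ → InInitial E P′ τ′
  InInitial-transfer E pts ag (c , μ , ts , c≢0 , lts , van , div) =
    c , μ , ts , c≢0 , lts ,
    (λ B′ pB′ → let B , pB , agB = pts B′ pB′ in
       trans (sym (evalPoly-cong E agB ((c , μ) ∷ ts))) (van B pB)) ,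
    subst (μ ∣ₘ_) (sqfree-cong E ag) div

  InInitial-resp : (∀ B → P′ B → P B) → InInitial E P τ → InInitial E P′ τ
  InInitial-resp P′⊆P = InInitial-transfer _ (λ B p → B , P′⊆P B p , agree-refl) agree-refl

  powℚ-+ : ∀ q a b → powℚ q (a ℕ.+ b) ≡ powℚ q a * powℚ q b
  powℚ-+ q zero    b = sym (ℚ.*-identityˡ _)
  powℚ-+ q (suc a) b = trans (cong (q *_) (powℚ-+ q a b)) (sym (ℚ.*-assoc q _ _))

  powℚ-1 : ∀ a → powℚ 1ℚ a ≡ 1ℚ
  powℚ-1 zero    = refl
  powℚ-1 (suc a) = trans (ℚ.*-identityˡ _) (powℚ-1 a)

  *-interchange : ∀ a b c d → (a * b) * (c * d) ≡ (a * c) * (b * d)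
  *-interchange = solve 4 (λ a b c d → (a :* b) :* (c :* d) := (a :* c) :* (b :* d)) refl

  evalMon-+ : ∀ E B (κ μ : Mon E) → evalMon E B (zipWith ℕ._+_ κ μ) ≡ evalMon E B κ * evalMon E B μ
  evalMon-+ [] B [] [] = refl
  evalMon-+ (x ∷ E) B (a ∷ κ) (b ∷ μ) with x ∈? B
  ... | yes _ = trans (cong₂ _*_ (powℚ-+ 1ℚ a b) (evalMon-+ E B κ μ)) (*-interchange (powℚ 1ℚ a) _ _ _)
  ... | no  _ = trans (cong₂ _*_ (powℚ-+ 0ℚ a b) (evalMon-+ E B κ μ)) (*-interchange (powℚ 0ℚ a) _ _ _)

  <lex-+ : ∀ {k} (κ : Vec ℕ k) {μ ν} → μ <lex ν → zipWith ℕ._+_ κ μ <lex zipWith ℕ._+_ κ ν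
  <lex-+ []      {[]}    {[]}    ()
  <lex-+ (a ∷ κ) {_ ∷ _} {_ ∷ _} (inj₁ lt)         = inj₁ (ℕ.+-monoʳ-< a lt)
  <lex-+ (a ∷ κ) {_ ∷ _} {_ ∷ _} (inj₂ (refl , lt)) = inj₂ (refl , <lex-+ κ lt)

  ∣ₘ-quotient : ∀ {k} {μ ν : Vec ℕ k} → μ ∣ₘ ν → ∃[ κ ] zipWith ℕ._+_ κ μ ≡ ν
  ∣ₘ-quotient []       = [] , refl
  ∣ₘ-quotient {μ = a ∷ _} {ν = b ∷ _} (le ∷ p) with ∣ₘ-quotient p
  ... | κ , eq = (b ℕ.∸ a) ∷ κ , cong₂ _∷_ (ℕ.m∸n+n≡m le) eq

  evalPoly-++ : ∀ E B f g → evalPoly E B (f ++ g) ≡ evalPoly E B f + evalPoly E B g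
  evalPoly-++ E B []            g = sym (ℚ.+-identityˡ _)
  evalPoly-++ E B ((c , μ) ∷ f) g =
    trans (cong (c * evalMon E B μ +_) (evalPoly-++ E B f g))
          (sym (ℚ.+-assoc (c * evalMon E B μ) (evalPoly E B f) (evalPoly E B g)))

  evalPoly-mulMon : ∀ E B c κ f →
    evalPoly E B (map (λ (q , μ) → c * q , zipWith ℕ._+_ κ μ) f) ≡ c * evalMon E B κ * evalPoly E B f
  evalPoly-mulMon E B c κ []            = sym (ℚ.*-zeroʳ (c * evalMon E B κ))
  evalPoly-mulMon E B c κ ((q , μ) ∷ f) =
    trans (cong₂ (λ u v → c * q * u + v) (evalMon-+ E B κ μ) (evalPoly-mulMon E B c κ f))
          (solve 5 (λ c q u v w → c :* q :* (u :* v) :+ c :* u :* w := c :* u :* (q :* v :+ w)) refl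
                 c q _ _ _)

  -- A witness normalised to leading coefficient 1 and leading monomial exactly `μ`. In the
  -- difference of two such witnesses for the same `μ` the leading terms cancel, which is what
  -- interpolation between the slices needs.
  Monic : (E : List ℕ) → BasisPred → Mon E → Set
  Monic E P μ = ∃[ ts ] (All (λ t → proj₂ t <lex μ) ts ×
                         (∀ B → P B → evalMon E B μ + evalPoly E B ts ≡ 0ℚ))

  -- Multiply the witness by `x^κ / c`, where `x^κ` is the quotient of `x^τ` by `x^μ`; lex is
  -- compatible with multiplication.
  InInitial⇒Monic : InInitial E P τ → Monic E P (sqfree E τ)
  InInitial⇒Monic {E} {P} {τ} (c , μ , ts , c≢0 , lts , van , div) with ∣ₘ-quotient div
  ... | κ , eq = map mul ts , subst (λ ν → All (λ t → proj₂ t <lex ν) (map mul ts)) eq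
                                (All.map⁺ (All.map (<lex-+ κ) lts)) , vanishes
    where
    instance _ = ≢-nonZero c≢0
    mul : ℚ × Mon E → ℚ × Mon E
    mul (q , ν) = 1/ c * q , zipWith ℕ._+_ κ ν
    open ≡-Reasoning
    vanishes : ∀ B → P B → evalMon E B (sqfree E τ) + evalPoly E B (map mul ts) ≡ 0ℚ
    vanishes B pB = begin
      evalMon E B (sqfree E τ) + evalPoly E B (map mul ts)
        ≡⟨ cong (_+ evalPoly E B (map mul ts))
                (trans (cong (evalMon E B) (sym eq)) (evalMon-+ E B κ μ)) ⟩
      k * u + evalPoly E B (map mul ts)
        ≡⟨ cong (k * u +_) (evalPoly-mulMon E B (1/ c) κ ts) ⟩
      k * u + 1/ c * k * v
        ≡⟨ cong (_+ 1/ c * k * v) (sym (ℚ.*-identityˡ (k * u))) ⟩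
      1ℚ * (k * u) + 1/ c * k * v
        ≡⟨ cong (λ z → z * (k * u) + 1/ c * k * v) (sym (ℚ.*-inverseˡ c)) ⟩
      1/ c * c * (k * u) + 1/ c * k * v
        ≡⟨ solve 5 (λ c′ c k u v → c′ :* c :* (k :* u) :+ c′ :* k :* v := c′ :* k :* (c :* u :+ v))
                 refl (1/ c) c k u v ⟩
      1/ c * k * (c * u + v)
        ≡⟨ cong (1/ c * k *_) (van B pB) ⟩
      1/ c * k * 0ℚ
        ≡⟨ ℚ.*-zeroʳ (1/ c * k) ⟩
      0ℚ ∎
      where k = evalMon E B κ
            u = evalMon E B μ
            v = evalPoly E B ts

  ∣ₘ-refl : ∀ {k} {μ : Vec ℕ k} → μ ∣ₘ μ
  ∣ₘ-refl {μ = []}    = []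
  ∣ₘ-refl {μ = _ ∷ _} = ℕ.≤-refl ∷ ∣ₘ-refl

  Monic⇒InInitial : Monic E P (sqfree E τ) → InInitial E P τ
  Monic⇒InInitial {E} {τ = τ} (ts , lts , van) =
    1ℚ , sqfree E τ , ts , (λ ()) , lts ,
    (λ B pB → trans (cong (_+ evalPoly E B ts) (ℚ.*-identityˡ (evalMon E B (sqfree E τ)))) (van B pB)) , ∣ₘ-refl

  InInitial-vacuous : (∀ B → ¬ P B) → InInitial E P τ
  InInitial-vacuous empty = Monic⇒InInitial ([] , [] , λ B pB → contradiction pB (empty B))

  -- Specialising the last variable to 0 or 1

  evalMon-snoc : ∀ E {m} B (ν : Mon E) a →
    evalMon (E ++ [ m ]) B (snocMon E ν a) ≡ evalMon E B ν * evalMon [ m ] B (a ∷ [])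
  evalMon-snoc [] B [] a = sym (ℚ.*-identityˡ _)
  evalMon-snoc (x ∷ E) B (v ∷ ν) a with x ∈? B
  ... | yes _ = trans (cong (powℚ 1ℚ v *_) (evalMon-snoc E B ν a)) (sym (ℚ.*-assoc (powℚ 1ℚ v) _ _))
  ... | no  _ = trans (cong (powℚ 0ℚ v *_) (evalMon-snoc E B ν a)) (sym (ℚ.*-assoc (powℚ 0ℚ v) _ _))

  -- `evalMon` branches on membership; recording the value `t` of the last coordinate lets one
  -- computation serve both slices.
  Coord : ℕ → List ℕ → ℚ → Set
  Coord m B t = ∀ a → evalMon [ m ] B (a ∷ []) ≡ powℚ t a

  coord-∈ : m ∈ B → Coord m B 1ℚ
  coord-∈ {m} {B} m∈B a with m ∈? B
  ... | yes _  = ℚ.*-identityʳ _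
  ... | no m∉B = contradiction m∈B m∉B

  coord-∉ : m ∉ B → Coord m B 0ℚ
  coord-∉ {m} {B} m∉B a with m ∈? B
  ... | yes m∈B = contradiction m∈B m∉B
  ... | no _    = ℚ.*-identityʳ _

  evalMon-coord : ∀ E {m B t} → Coord m B t → (ν : Mon E) → ∀ a →
    evalMon (E ++ [ m ]) B (snocMon E ν a) ≡ evalMon E B ν * powℚ t a
  evalMon-coord E {B = B} xm ν a = trans (evalMon-snoc E B ν a) (cong (evalMon E B ν *_) (xm a))

  -- Setting x_m = t in terms below x^ν x_m^b, b ≤ 1: the coefficient c of x^ν comes only from
  -- terms x^ν x_m^0, hence does not depend on t.
  specialise : ∀ E {m} (ν : Mon E) {b} → b ≤ 1 →
    ∀ ts → All (λ t → proj₂ t <lex snocMon E {m} ν b) ts →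
    ∃[ c ] ((b ≡ 0 → c ≡ 0ℚ) × ∀ t → ∃[ ts′ ] (All (λ t → proj₂ t <lex ν) ts′ ×
      (∀ {B} → Coord m B t → evalPoly (E ++ [ m ]) B ts ≡ c * evalMon E B ν + evalPoly E B ts′)))
  specialise E ν b≤1 [] [] =
    0ℚ , (λ _ → refl) , λ t → [] , [] , λ {B} _ → sym (cong (_+ 0ℚ) (ℚ.*-zeroˡ (evalMon E B ν)))
  specialise E ν b≤1 ((q , μ) ∷ ts) (lt ∷ lts) with unsnocMon E μ | specialise E ν b≤1 ts lts
  ... | κ , a , refl | c , b≡0⇒c≡0 , spec with <lex-snoc⁻ E lt
  ... | inj₁ κ<ν = c , b≡0⇒c≡0 , λ t → let ts′ , lts′ , ev = spec t in
        (q * powℚ t a , κ) ∷ ts′ , κ<ν ∷ lts′ , λ {B} xm →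
        trans (cong₂ (λ u v → q * u + v) (evalMon-coord E xm κ a) (ev xm))
              (solve 5 (λ q k p cv r → q :* (k :* p) :+ (cv :+ r) := cv :+ (q :* p :* k :+ r)) refl
                 q (evalMon E B κ) (powℚ t a) (c * evalMon E B ν) (evalPoly E B ts′))
  ... | inj₂ (refl , a<b) with ℕ.<-≤-trans a<b b≤1
  ... | s≤s z≤n = q + c , (λ b≡0 → contradiction (subst (0 <_) b≡0 a<b) λ ()) ,
        λ t → let ts′ , lts′ , ev = spec t in
        ts′ , lts′ , λ {B} xm →
        trans (cong₂ (λ u v → q * u + v) (evalMon-coord E xm κ 0) (ev xm))
              (solve 4 (λ q k c r → q :* (k :* con 1ℚ) :+ (c :* k :+ r) := (q :+ c) :* k :+ r) refl
                 q (evalMon E B κ) c (evalPoly E B ts′))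

  -- The leading monomial divides `x^τ`, so it does not involve `x_m`. In this case `specialise`
  -- gives `c′ ≡ 0ℚ`, and setting `x_m` to 0 or to 1 keeps the leading term.
  InInitial-snoc-∉⁻ : ∀ E → m ∉ τ → InInitial (E ++ [ m ]) P τ →
    InInitial E (λ B → P B × m ∉ B) τ × InInitial E (λ B → P B × m ∈ B) τ
  InInitial-snoc-∉⁻ {m} {τ} {P} E m∉τ (c , μ , ts , c≢0 , lts , van , div) with unsnocMon E μ
  ... | ν , b , refl with ∣ₘ-snoc⁻ E (subst (snocMon E ν b ∣ₘ_) (sqfree-snoc-∉ E m∉τ) div)
  ... | ν∣τ , z≤n with specialise E ν z≤n ts lts
  ... | c′ , c′≡0 , spec = at 0ℚ coord-∉ , at 1ℚ coord-∈
    where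
    at : ∀ t {Q : BasisPred} → (∀ {B} → Q B → Coord m B t) → InInitial E (λ B → P B × Q B) τ
    at t coord with spec t
    ... | ts′ , lts′ , ev = c , ν , ts′ , c≢0 , lts′ , (λ B (pB , qB) →
      trans (sym (trans (cong₂ (λ u v → c * u + v) (evalMon-coord E (coord qB) ν 0) (ev (coord qB)))
        (trans (cong (λ z → c * (evalMon E B ν * 1ℚ) + (z * evalMon E B ν + evalPoly E B ts′)) (c′≡0 refl))
          (solve 3 (λ c k r → c :* (k :* con 1ℚ) :+ (con 0ℚ :* k :+ r) := c :* k :+ r) refl
             c (evalMon E B ν) (evalPoly E B ts′))))) (van B pB)) , ν∣τ

  -- Setting `x_m = t` leaves the coefficient `c t^b + c′` at `x^ν`. If `x^τ` is standard for both
  -- slices, this is zero at 0 and at 1; then `c′` and `c` vanish one after the other, against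
  -- `c ≢ 0ℚ`.
  InInitial-snoc-∈⁻ : ∀ E → m ∈ τ → InInitial (E ++ [ m ]) P τ →
    ¬ InInitial E (λ B → P B × m ∉ B) τ → ¬ InInitial E (λ B → P B × m ∈ B) τ → ⊥
  InInitial-snoc-∈⁻ {m} {τ} {P} E m∈τ (c , μ , ts , c≢0 , lts , van , div) ¬I₀ ¬I₁ with unsnocMon E μ
  ... | ν , b , refl with ∣ₘ-snoc⁻ E (subst (snocMon E ν b ∣ₘ_) (sqfree-snoc-∈ E m∈τ) div)
  ... | ν∣τ , b≤1 with specialise E ν b≤1 ts lts
  ... | c′ , c′≡0 , spec = contradiction I₁ ¬I₁
    where
    at : ∀ t {Q : BasisPred} → (∀ {B} → Q B → Coord m B t) → c * powℚ t b + c′ ≢ 0ℚ →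
         InInitial E (λ B → P B × Q B) τ
    at t coord lc≢0 with spec t
    ... | ts′ , lts′ , ev = c * powℚ t b + c′ , ν , ts′ , lc≢0 , lts′ , (λ B (pB , qB) →
      trans (sym (trans (cong₂ (λ u v → c * u + v) (evalMon-coord E (coord qB) ν b) (ev (coord qB)))
          (solve 5 (λ c p c′ k r → c :* (k :* p) :+ (c′ :* k :+ r) := (c :* p :+ c′) :* k :+ r) refl
             c (powℚ t b) c′ (evalMon E B ν) (evalPoly E B ts′)))) (van B pB)) , ν∣τ
    c′-zero : ∀ {b} → b ≤ 1 → (b ≡ 0 → c′ ≡ 0ℚ) →
      (c * powℚ 0ℚ b + c′ ≢ 0ℚ → InInitial E (λ B → P B × m ∉ B) τ) → c′ ≡ 0ℚ
    c′-zero z≤n       h _ = h refl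
    c′-zero (s≤s z≤n) _ h with c′ ℚ.≟ 0ℚ
    ... | yes eq = eq
    ... | no neq = contradiction (h (λ e → neq (trans (sym
            (solve 2 (λ c c′ → c :* (con 0ℚ :* con 1ℚ) :+ c′ := c′) refl c c′)) e))) ¬I₀
    I₁ : InInitial E (λ B → P B × m ∈ B) τ
    I₁ = at 1ℚ coord-∈ λ e → c≢0 (trans (sym (trans
           (cong₂ (λ u v → c * u + v) (powℚ-1 b) (c′-zero b≤1 c′≡0 (at 0ℚ coord-∉)))
           (solve 1 (λ c → c :* con 1ℚ :+ con 0ℚ := c) refl c))) e)

  -- Lifting witnesses from the slices

  scaleSnoc : ∀ E → ℚ → ℕ → List (ℚ × Mon E) → List (ℚ × Mon (E ++ [ m ]))
  scaleSnoc E c a = map (λ (q , κ) → c * q , snocMon E κ a)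

  evalPoly-scaleSnoc : ∀ E {m B t} → Coord m B t → ∀ c a f →
    evalPoly (E ++ [ m ]) B (scaleSnoc E c a f) ≡ c * powℚ t a * evalPoly E B f
  evalPoly-scaleSnoc E {t = t} xm c a [] = sym (ℚ.*-zeroʳ (c * powℚ t a))
  evalPoly-scaleSnoc E {B = B} {t} xm c a ((q , κ) ∷ f) =
    trans (cong₂ (λ u v → c * q * u + v) (evalMon-coord E xm κ a) (evalPoly-scaleSnoc E xm c a f))
          (solve 5 (λ c q k p r → c :* q :* (k :* p) :+ c :* p :* r := c :* p :* (q :* k :+ r)) refl
             c q (evalMon E B κ) (powℚ t a) (evalPoly E B f))

  scaleSnoc-< : ∀ E {m ν b} c a {f} → All (λ t → proj₂ t <lex ν) f →
    All (λ t → proj₂ t <lex snocMon E {m} ν b) (scaleSnoc E c a f)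
  scaleSnoc-< E c a lts = All.map⁺ (All.map (<lex-snoc-init E) lts)

  coord : ∀ m B → (m ∈ B × Coord m B 1ℚ) ⊎ (m ∉ B × Coord m B 0ℚ)
  coord m B = [ (λ m∈B → inj₁ (m∈B , coord-∈ m∈B)) , (λ m∉B → inj₂ (m∉B , coord-∉ m∉B)) ]′
                (toSum (m ∈? B))

  interpolate₁ : ∀ a b → 1ℚ * a + (1ℚ + - 1ℚ) * b ≡ a
  interpolate₁ = solve 2 (λ a b → con 1ℚ :* a :+ (con 1ℚ :+ (:- con 1ℚ)) :* b := a) refl

  interpolate₀ : ∀ a b → 0ℚ * a + (1ℚ + - 0ℚ) * b ≡ b
  interpolate₀ = solve 2 (λ a b → con 0ℚ :* a :+ (con 1ℚ :+ (:- con 0ℚ)) :* b := b) refl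

  -- f₀ + x_m (f₁ - f₀)
  Monic-interpolate : ∀ E (σ : Mon E) → Monic E (λ B → P B × m ∉ B) σ → Monic E (λ B → P B × m ∈ B) σ →
    Monic (E ++ [ m ]) P (snocMon E σ 0)
  Monic-interpolate {P} {m} E σ (f₀ , lt₀ , van₀) (f₁ , lt₁ , van₁) =
    s₀ ++ s₁ ++ s₂ ,
    All.++⁺ (scaleSnoc-< E 1ℚ 0 lt₀) (All.++⁺ (scaleSnoc-< E 1ℚ 1 lt₁) (scaleSnoc-< E (- 1ℚ) 1 lt₀)) ,
    van
    where
    s₀ = scaleSnoc E 1ℚ 0 f₀
    s₁ = scaleSnoc E 1ℚ 1 f₁
    s₂ = scaleSnoc E (- 1ℚ) 1 f₀
    v₀ v₁ : List ℕ → ℚ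
    v₀ B = evalMon E B σ + evalPoly E B f₀
    v₁ B = evalMon E B σ + evalPoly E B f₁
    value : ∀ {B t} → Coord m B t →
      evalMon (E ++ [ m ]) B (snocMon E σ 0) + evalPoly (E ++ [ m ]) B (s₀ ++ s₁ ++ s₂)
        ≡ t * v₁ B + (1ℚ + - t) * v₀ B
    value {B} {t} xm =
      trans (cong₂ _+_ (evalMon-coord E xm σ 0)
        (trans (evalPoly-++ (E ++ [ m ]) B s₀ (s₁ ++ s₂)) (cong₂ _+_ (evalPoly-scaleSnoc E xm 1ℚ 0 f₀)
          (trans (evalPoly-++ (E ++ [ m ]) B s₁ s₂) (cong₂ _+_ (evalPoly-scaleSnoc E xm 1ℚ 1 f₁)
            (evalPoly-scaleSnoc E xm (- 1ℚ) 1 f₀))))))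
        (solve 4 (λ s t e₀ e₁ → s :* con 1ℚ :+ (con 1ℚ :* con 1ℚ :* e₀ :+ (con 1ℚ :* (t :* con 1ℚ) :* e₁
                     :+ con (- 1ℚ) :* (t :* con 1ℚ) :* e₀))
                   := t :* (s :+ e₁) :+ (con 1ℚ :+ (:- t)) :* (s :+ e₀)) refl
           (evalMon E B σ) t (evalPoly E B f₀) (evalPoly E B f₁))
    van : ∀ B → P B → evalMon (E ++ [ m ]) B (snocMon E σ 0)
                      + evalPoly (E ++ [ m ]) B (s₀ ++ s₁ ++ s₂) ≡ 0ℚ
    van B pB with coord m B
    ... | inj₁ (m∈B , xm) = trans (value xm) (trans (interpolate₁ (v₁ B) (v₀ B)) (van₁ B (pB , m∈B)))
    ... | inj₂ (m∉B , xm) = trans (value xm) (trans (interpolate₀ (v₁ B) (v₀ B)) (van₀ B (pB , m∉B)))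

  -- x_m f₁
  Monic-extend-∈ : ∀ E (σ : Mon E) → Monic E (λ B → P B × m ∈ B) σ → Monic (E ++ [ m ]) P (snocMon E σ 1)
  Monic-extend-∈ {P} {m} E σ (f₁ , lt₁ , van₁) = scaleSnoc E 1ℚ 1 f₁ , scaleSnoc-< E 1ℚ 1 lt₁ , van
    where
    value : ∀ {B t} → Coord m B t →
      evalMon (E ++ [ m ]) B (snocMon E σ 1) + evalPoly (E ++ [ m ]) B (scaleSnoc E 1ℚ 1 f₁)
        ≡ t * (evalMon E B σ + evalPoly E B f₁)
    value {B} {t} xm =
      trans (cong₂ _+_ (evalMon-coord E xm σ 1) (evalPoly-scaleSnoc E xm 1ℚ 1 f₁))
        (solve 3 (λ s t e → s :* (t :* con 1ℚ) :+ con 1ℚ :* (t :* con 1ℚ) :* e := t :* (s :+ e)) refl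
           (evalMon E B σ) t (evalPoly E B f₁))
    van : ∀ B → P B → evalMon (E ++ [ m ]) B (snocMon E σ 1)
                      + evalPoly (E ++ [ m ]) B (scaleSnoc E 1ℚ 1 f₁) ≡ 0ℚ
    van B pB with coord m B
    ... | inj₁ (m∈B , xm) = trans (value xm) (trans (ℚ.*-identityˡ (evalMon E B σ + evalPoly E B f₁)) (van₁ B (pB , m∈B)))
    ... | inj₂ (m∉B , xm) = trans (value xm) (ℚ.*-zeroˡ (evalMon E B σ + evalPoly E B f₁))

  -- x_m f₀ - f₀
  Monic-extend-∉ : ∀ E (σ : Mon E) → Monic E (λ B → P B × m ∉ B) σ → Monic (E ++ [ m ]) P (snocMon E σ 1)
  Monic-extend-∉ {P} {m} E σ (f₀ , lt₀ , van₀) =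
    s₁ ++ (- 1ℚ , snocMon E σ 0) ∷ s₀ ,
    All.++⁺ (scaleSnoc-< E 1ℚ 1 lt₀) (<lex-snoc-last E σ (s≤s z≤n) ∷ scaleSnoc-< E (- 1ℚ) 0 lt₀) ,
    van
    where
    s₁ = scaleSnoc E 1ℚ 1 f₀
    s₀ = scaleSnoc E (- 1ℚ) 0 f₀
    value : ∀ {B t} → Coord m B t →
      evalMon (E ++ [ m ]) B (snocMon E σ 1)
      + evalPoly (E ++ [ m ]) B (s₁ ++ (- 1ℚ , snocMon E σ 0) ∷ s₀)
        ≡ (t + - 1ℚ) * (evalMon E B σ + evalPoly E B f₀)
    value {B} {t} xm =
      trans (cong₂ _+_ (evalMon-coord E xm σ 1)
        (trans (evalPoly-++ (E ++ [ m ]) B s₁ ((- 1ℚ , snocMon E σ 0) ∷ s₀)) (cong₂ _+_ (evalPoly-scaleSnoc E xm 1ℚ 1 f₀)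
          (cong₂ (λ u v → - 1ℚ * u + v) (evalMon-coord E xm σ 0) (evalPoly-scaleSnoc E xm (- 1ℚ) 0 f₀)))))
        (solve 3 (λ s t e → s :* (t :* con 1ℚ) :+ (con 1ℚ :* (t :* con 1ℚ) :* e
                     :+ (con (- 1ℚ) :* (s :* con 1ℚ) :+ con (- 1ℚ) :* con 1ℚ :* e))
                   := (t :+ con (- 1ℚ)) :* (s :+ e)) refl
           (evalMon E B σ) t (evalPoly E B f₀))
    van : ∀ B → P B → evalMon (E ++ [ m ]) B (snocMon E σ 1)
                      + evalPoly (E ++ [ m ]) B (s₁ ++ (- 1ℚ , snocMon E σ 0) ∷ s₀) ≡ 0ℚ
    van B pB with coord m B
    ... | inj₁ (m∈B , xm) = trans (value xm) (trans (cong (_* v) (ℚ.+-inverseʳ 1ℚ)) (ℚ.*-zeroˡ v))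
      where v = evalMon E B σ + evalPoly E B f₀
    ... | inj₂ (m∉B , xm) = trans (value xm) (trans (cong ((0ℚ + - 1ℚ) *_) (van₀ B (pB , m∉B))) (ℚ.*-zeroʳ (0ℚ + - 1ℚ)))

  InInitial-snoc-∉⁺ : ∀ E → m ∉ τ →
    InInitial E (λ B → P B × m ∉ B) τ → InInitial E (λ B → P B × m ∈ B) τ →
    InInitial (E ++ [ m ]) P τ
  InInitial-snoc-∉⁺ {m} {τ} {P} E m∉τ I₀ I₁ =
    Monic⇒InInitial (subst (Monic (E ++ [ m ]) P) (sym (sqfree-snoc-∉ E m∉τ))
      (Monic-interpolate E (sqfree E τ) (InInitial⇒Monic I₀) (InInitial⇒Monic I₁)))

  InInitial-snoc-∈⁺ : ∀ E → m ∈ τ →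
    InInitial E (λ B → P B × m ∉ B) τ ⊎ InInitial E (λ B → P B × m ∈ B) τ →
    InInitial (E ++ [ m ]) P τ
  InInitial-snoc-∈⁺ {m} {τ} {P} E m∈τ I =
    Monic⇒InInitial (subst (Monic (E ++ [ m ]) P) (sym (sqfree-snoc-∈ E m∈τ))
      ([ Monic-extend-∉ E (sqfree E τ) ∘ InInitial⇒Monic
       , Monic-extend-∈ E (sqfree E τ) ∘ InInitial⇒Monic ]′ I))

open import Data.Nat using (_+_)

-- Strictly increasing lists

∈-snoc⁻ : ∀ {m x : ℕ} xs → x ∈ xs ++ [ m ] → x ∈ xs ⊎ x ≡ m
∈-snoc⁻ xs x∈ with ∈-++⁻ xs x∈
... | inj₁ p          = inj₁ p
... | inj₂ (here eq)  = inj₂ eq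

∈-snoc-last : ∀ {m : ℕ} xs → m ∈ xs ++ [ m ]
∈-snoc-last xs = ∈-++⁺ʳ xs (here refl)

strict-snoc⁺ : ∀ {xs} → Strict xs → All (_< m) xs → Strict (xs ++ [ m ])
strict-snoc⁺ s lt =
  AllPairs⇒Linked (AllPairs.++⁺ (Linked⇒AllPairs ℕ.<-trans s) ([] ∷ []) (All.map (_∷ []) lt))

strict-snoc⁻ : ∀ xs → Strict (xs ++ [ m ]) → Strict xs × All (_< m) xs
strict-snoc⁻ []           _         = [] , []
strict-snoc⁻ (x ∷ [])     (lt ∷ _)  = [-] , lt ∷ []
strict-snoc⁻ (x ∷ y ∷ xs) (lt ∷ s)  with strict-snoc⁻ (y ∷ xs) s
... | s′ , y< ∷ xs< = lt ∷ s′ , ℕ.<-trans lt y< ∷ y< ∷ xs<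

all<⇒∉ : ∀ {xs} → All (_< m) xs → m ∉ xs
all<⇒∉ lts m∈xs = ℕ.<-irrefl refl (All.lookup lts m∈xs)

remove-∉ : ∀ {xs} → m ∉ xs → remove m xs ≡ xs
remove-∉ {m} m∉xs = List.filter-all (λ x → ¬? (x ℕ.≟ m)) (All.tabulate λ x∈xs x≡m → m∉xs (subst (_∈ _) x≡m x∈xs))

remove-snoc : ∀ xs → m ∉ xs → remove m (xs ++ [ m ]) ≡ xs
remove-snoc {m} xs m∉xs = trans (List.filter-++ m≢? xs [ m ])
  (trans (cong₂ _++_ (remove-∉ m∉xs) (List.filter-none m≢? ((λ m≢m → m≢m refl) ∷ []))) (List.++-identityʳ xs))
  where m≢? = λ x → ¬? (x ℕ.≟ m)

range-snoc : ∀ n → range n ++ [ suc n ] ≡ range (suc n)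
range-snoc = List.applyUpTo-∷ʳ suc

range-≤ : ∀ {x} → x ∈ range n → x ≤ n
range-≤ x∈ with ∈-applyUpTo⁻ suc x∈
... | i , i<n , refl = i<n

strict-range : ∀ n → Strict (range n)
strict-range zero    = []
strict-range (suc n) = subst Strict (range-snoc n) (strict-snoc⁺ (strict-range n) (All.tabulate (s≤s ∘ range-≤)))

-- In a strictly increasing list over `range (suc n)` the entry `suc n` can only be the last, so its
-- membership becomes a question about the shape of the list.
data LastView (n : ℕ) : List ℕ → Set where
  inside : ∀ {τ} → τ ⊆ range n → suc n ∉ τ → LastView n τ
  snoc   : ∀ σ → Strict σ → σ ⊆ range n → suc n ∉ σ → LastView n (σ ++ [ suc n ])

range-pred : ∀ {x} → x ∈ range (suc n) → x ≢ suc n → x ∈ range n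
range-pred {n} {x} x∈ x≢ with ∈-snoc⁻ (range n) (subst (x ∈_) (sym (range-snoc n)) x∈)
... | inj₁ p  = p
... | inj₂ eq = contradiction eq x≢

range-suc : ∀ {x} → x ∈ range n → x ∈ range (suc n)
range-suc {n} {x} x∈ = subst (x ∈_) (range-snoc n) (∈-++⁺ˡ x∈)

lastView : ∀ {τ} → Strict τ → τ ⊆ range (suc n) → LastView n τ
lastView {n} {τ} s τ⊆ = go (reverseView τ) s τ⊆
  where
  go : ∀ {τ} → Reverse τ → Strict τ → τ ⊆ range (suc n) → LastView n τ
  go []               _ _  = inside (λ ()) (λ ())
  go (xs ∶ _ ∶ʳ x) s τ⊆ with strict-snoc⁻ xs s | x ℕ.≟ suc n
  ... | s′ , lts | yes refl = snoc xs s′ (λ y∈ → range-pred (τ⊆ (∈-++⁺ˡ y∈)) λ { refl → all<⇒∉ lts y∈ }) (all<⇒∉ lts)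
  ... | s′ , lts | no x≢    = inside (λ y∈ → range-pred (τ⊆ y∈) (λ { refl → ∉τ y∈ })) ∉τ
    where
    ∉τ : suc n ∉ xs ++ [ x ]
    ∉τ p with ∈-snoc⁻ xs p
    ... | inj₂ eq = x≢ (sym eq)
    ... | inj₁ q  = ℕ.<⇒≱ (All.lookup lts q) (range-≤ (τ⊆ (∈-snoc-last xs)))

-- Words and their unmarked positions

-- Words are stored last letter first.
Word : ℕ → Set
Word = Vec Step

path : Word n → List Step
path []      = []
path (s ∷ r) = path r ++ [ s ]

#e : Word n → ℕ
#e []      = 0
#e (𝐞 ∷ r) = suc (#e r)
#e (𝐧 ∷ r) = #e r

positions : Word n → List ℕ
positions []                = []
positions (𝐧 ∷ r)           = positions r
positions {suc n} (𝐞 ∷ r) = positions r ++ [ suc n ]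

-- the number of 𝐧's minus the number of unmarked 𝐞's
height : Word n → ℕ
height []      = 0
height (𝐧 ∷ r) = suc (height r)
height (𝐞 ∷ r) = pred (height r)

-- Height zero means that the two numbers compared by the statistic agree, so the 𝐞 is marked. The
-- height is an explicit argument so that it can be replaced by an equal one.
unmarkedAt : ℕ → ℕ → List ℕ → List ℕ
unmarkedAt m zero    τ = τ
unmarkedAt m (suc _) τ = τ ++ [ m ]

unmarked : Word n → List ℕ
unmarked []              = []
unmarked (𝐧 ∷ r)         = unmarked r
unmarked {suc n} (𝐞 ∷ r) = unmarkedAt (suc n) (height r) (unmarked r)

positions-⊆ : (r : Word n) → positions r ⊆ range n
positions-⊆ []      ()
positions-⊆ (𝐧 ∷ r) x∈ = range-suc (positions-⊆ r x∈)
positions-⊆ {suc n} (𝐞 ∷ r) {x} x∈ with ∈-snoc⁻ (positions r) x∈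
... | inj₁ p    = range-suc (positions-⊆ r p)
... | inj₂ refl = subst (x ∈_) (range-snoc n) (∈-snoc-last (range n))

⊆range⇒< : ∀ {xs} → xs ⊆ range n → All (_< suc n) xs
⊆range⇒< xs⊆ = All.tabulate (s≤s ∘ range-≤ ∘ xs⊆)

⊆range⇒∉ : ∀ {xs} → xs ⊆ range n → suc n ∉ xs
⊆range⇒∉ xs⊆ = all<⇒∉ (⊆range⇒< xs⊆)

positions-∉ : (r : Word n) → suc n ∉ positions r
positions-∉ r = ⊆range⇒∉ (positions-⊆ r)

positions-strict : (r : Word n) → Strict (positions r)
positions-strict []      = []
positions-strict (𝐧 ∷ r) = positions-strict r
positions-strict (𝐞 ∷ r) = strict-snoc⁺ (positions-strict r) (⊆range⇒< (positions-⊆ r))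

unmarkedAt-⊆ : ∀ {τ σ : List ℕ} h → τ ⊆ σ → unmarkedAt m h τ ⊆ σ ++ [ m ]
unmarkedAt-⊆ zero    τ⊆ x∈ = ∈-++⁺ˡ (τ⊆ x∈)
unmarkedAt-⊆ {τ = τ} (suc h) τ⊆ x∈ with ∈-snoc⁻ τ x∈
... | inj₁ p    = ∈-++⁺ˡ (τ⊆ p)
... | inj₂ refl = ∈-snoc-last _

unmarked-⊆ : (r : Word n) → unmarked r ⊆ positions r
unmarked-⊆ []      ()
unmarked-⊆ (𝐧 ∷ r) = unmarked-⊆ r
unmarked-⊆ (𝐞 ∷ r) = unmarkedAt-⊆ (height r) (unmarked-⊆ r)

unmarked-⊆range : (r : Word n) → unmarked r ⊆ range n
unmarked-⊆range r = positions-⊆ r ∘ unmarked-⊆ r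

unmarked-∉ : (r : Word n) → suc n ∉ unmarked r
unmarked-∉ r = ⊆range⇒∉ (unmarked-⊆range r)

unmarked-strict : (r : Word n) → Strict (unmarked r)
unmarked-strict []      = []
unmarked-strict (𝐧 ∷ r) = unmarked-strict r
unmarked-strict (𝐞 ∷ r) with height r
... | zero  = unmarked-strict r
... | suc _ = strict-snoc⁺ (unmarked-strict r) (⊆range⇒< (unmarked-⊆range r))

-- The term in parentheses is the number of 𝐧's: a final 𝐞 at height zero changes neither summand,
-- and otherwise it moves one unit from `height` to `unmarked`.
height-invariant : (r : Word n) → #e r + (height r + length (unmarked r)) ≡ n
height-invariant []      = refl
height-invariant (𝐧 ∷ r) = trans (ℕ.+-suc _ _) (cong suc (height-invariant r))
height-invariant {suc n} (𝐞 ∷ r) with height r | height-invariant r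
... | zero  | eq = cong suc eq
... | suc h | eq = cong suc (trans (cong (λ k → #e r + (h + k)) (List.length-++-comm (unmarked r) [ suc n ]))
                     (trans (cong (#e r +_) (ℕ.+-suc h _)) eq))

height-unique : (r r′ : Word n) → #e r ≡ #e r′ → unmarked r ≡ unmarked r′ → height r ≡ height r′
height-unique r r′ e≡ u≡ = ℕ.+-cancelʳ-≡ (length (unmarked r)) _ _ (ℕ.+-cancelˡ-≡ (#e r) _ _
  (trans (height-invariant r) (trans (sym (height-invariant r′))
    (sym (cong₂ (λ e τ → e + (height r′ + length τ)) e≡ u≡)))))

height-east : (r r′ : Word n) → #e r′ ≡ suc (#e r) → unmarked r ≡ unmarked r′ → height r ≡ suc (height r′)
height-east r r′ e≡ u≡ = ℕ.+-cancelʳ-≡ (length (unmarked r)) _ _ (ℕ.+-cancelˡ-≡ (#e r) _ _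
  (trans (height-invariant r) (trans (sym (height-invariant r′))
    (trans (cong₂ (λ e τ → e + (height r′ + length τ)) e≡ (sym u≡)) (sym (ℕ.+-suc _ _))))))

-- A tail of the word is a prefix of the path, so there is one bound for each nonempty prefix.
data Below (u : ℕ → ℕ) : Word n → Set where
  []  : Below u []
  _∷_ : ∀ {s} {r : Word n} → u (suc n) ≤ #e (s ∷ r) → Below u r → Below u (s ∷ r)

-- Turn the first 𝐧 not matched by an unmarked 𝐞 into an 𝐞; that 𝐞 is then marked.
flip : (r : Word n) → ∀ {h} → height r ≡ suc h → Σ[ r′ ∈ Word n ]
  (#e r′ ≡ suc (#e r) × unmarked r′ ≡ unmarked r × height r′ ≡ h × (∀ {u} → Below u r → Below u r′))
flip {suc n} (𝐧 ∷ r) {zero} ht =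
  𝐞 ∷ r , refl , cong (λ h → unmarkedAt (suc n) h (unmarked r)) ht₀ , cong pred ht₀ ,
  λ { (le ∷ b) → ℕ.m≤n⇒m≤1+n le ∷ b }
  where ht₀ = ℕ.suc-injective ht
flip (𝐧 ∷ r) {suc h} ht with flip r (ℕ.suc-injective ht)
... | r′ , e≡ , u≡ , h≡ , below = 𝐧 ∷ r′ , e≡ , u≡ , cong suc h≡ ,
  λ { (le ∷ b) → ℕ.≤-trans (ℕ.m≤n⇒m≤1+n le) (ℕ.≤-reflexive (sym e≡)) ∷ below b }
flip {suc n} (𝐞 ∷ r) {h} ht with height r in hr
-- `pred (height r)` is positive, so the height of `r` is at least 2; after the flip lowers it by
-- one, the final 𝐞 is still unmarked.
... | suc (suc k) with flip r hr
... | r′ , e≡ , u≡ , h≡ , below = 𝐞 ∷ r′ , cong suc e≡ ,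
  trans (cong (λ h → unmarkedAt (suc n) h (unmarked r′)) h≡) (cong (_++ [ suc n ]) u≡) ,
  trans (cong pred h≡) (ℕ.suc-injective ht) ,
  λ { (le ∷ b) → ℕ.≤-trans (ℕ.m≤n⇒m≤1+n le) (ℕ.≤-reflexive (sym (cong suc e≡))) ∷ below b }

-- Basis exchange

data EastAt : ℕ → Word n → Set where
  here  : ∀ {r : Word n} → EastAt (suc n) (𝐞 ∷ r)
  there : ∀ {s z} {r : Word n} → EastAt z r → EastAt z (s ∷ r)

eastAt-≤ : ∀ {z} {r : Word n} → EastAt z r → z ≤ n
eastAt-≤ here      = ℕ.≤-refl
eastAt-≤ (there p) = ℕ.m≤n⇒m≤1+n (eastAt-≤ p)

eastAt-≢ : ∀ {z} {r : Word n} → EastAt z r → z ≢ suc n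
eastAt-≢ p refl = ℕ.<-irrefl refl (eastAt-≤ p)

∈⇒eastAt : ∀ {z} (r : Word n) → z ∈ positions r → EastAt z r
∈⇒eastAt (𝐧 ∷ r) z∈ = there (∈⇒eastAt r z∈)
∈⇒eastAt (𝐞 ∷ r) z∈ with ∈-snoc⁻ (positions r) z∈
... | inj₁ p    = there (∈⇒eastAt r p)
... | inj₂ refl = here

eastAt⇒∈ : ∀ {z} {r : Word n} → EastAt z r → z ∈ positions r
eastAt⇒∈ {r = 𝐞 ∷ r} here      = ∈-snoc-last (positions r)
eastAt⇒∈ {r = 𝐞 ∷ r} (there p) = ∈-++⁺ˡ (eastAt⇒∈ p)
eastAt⇒∈ {r = 𝐧 ∷ r} (there p) = eastAt⇒∈ p

#e-cong : ∀ s {r r′ : Word n} → #e r ≡ #e r′ → #e (s ∷ r) ≡ #e (s ∷ r′)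
#e-cong 𝐞 = cong suc
#e-cong 𝐧 eq = eq

#e-suc : ∀ s {r r′ : Word n} → suc (#e r) ≡ #e r′ → suc (#e (s ∷ r)) ≡ #e (s ∷ r′)
#e-suc 𝐞 = cong suc
#e-suc 𝐧 eq = eq

module _ (u : ℕ → ℕ) where

  Augmentation : Word n → Word n → Set
  Augmentation {n} a b =
    ∃[ y ] (EastAt y b × ¬ EastAt y a × Σ[ c ∈ Word n ] (#e c ≡ suc (#e a) × Below u c ×
      (∀ z → EastAt z c ⇔ (EastAt z a ⊎ z ≡ y))))

  augment-∷ : ∀ s t {a b : Word n} → u (suc n) ≤ #e (s ∷ a) →
    Augmentation a b → Augmentation (s ∷ a) (t ∷ b)
  augment-∷ s t le (y , y∈b , y∉a , c , e≡ , below , iff) =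
    y , there y∈b , (λ { here → eastAt-≢ y∈b refl ; (there p) → y∉a p }) ,
    s ∷ c , e≡′ , ℕ.≤-trans le (ℕ.≤-trans (ℕ.n≤1+n _) (ℕ.≤-reflexive (sym e≡′))) ∷ below ,
    λ z → mk⇔ (λ { here → inj₁ here ; (there p) → [ inj₁ ∘ there , inj₂ ]′ (to (iff z) p) })
              (λ { (inj₁ here) → here ; (inj₁ (there p)) → there (from (iff z) (inj₁ p))
                 ; (inj₂ eq) → there (from (iff z) (inj₂ eq)) })
    where e≡′ = sym (#e-suc s (sym e≡))

  -- The new 𝐞 goes to the last position where `a` has 𝐧 and `b` has 𝐞: for any other pair of last
  -- letters the strict inequality passes to the prefixes. Turning an 𝐧 into an 𝐞 only raises prefix
  -- counts, so the bounds survive.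
  augment : (a b : Word n) → Below u a → #e a < #e b → Augmentation a b
  augment {suc n} (𝐧 ∷ a) (𝐞 ∷ b) (le ∷ below) lt =
    suc n , here , (λ { (there p) → eastAt-≢ p refl }) , 𝐞 ∷ a , refl , ℕ.m≤n⇒m≤1+n le ∷ below ,
    λ z → mk⇔ (λ { here → inj₂ refl ; (there p) → inj₁ (there p) })
              (λ { (inj₁ (there p)) → there p ; (inj₂ refl) → here })
  augment (𝐧 ∷ a) (𝐧 ∷ b) (le ∷ below) lt = augment-∷ 𝐧 𝐧 le (augment a b below lt)
  augment (𝐞 ∷ a) (𝐞 ∷ b) (le ∷ below) lt = augment-∷ 𝐞 𝐞 le (augment a b below (ℕ.≤-pred lt))
  augment (𝐞 ∷ a) (𝐧 ∷ b) (le ∷ below) lt =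
    augment-∷ 𝐞 𝐧 le (augment a b below (ℕ.<-trans (ℕ.n<1+n _) lt))

  Exchange : ℕ → Word n → Word n → Set
  Exchange {n} x a b =
    ∃[ y ] (EastAt y b × ¬ EastAt y a × Σ[ c ∈ Word n ] (#e c ≡ #e a × Below u c ×
      (∀ z → EastAt z c ⇔ ((EastAt z a × z ≢ x) ⊎ z ≡ y))))

  -- The inequality `#e b ≤ #e c` is the invariant of the scan: through it the word without `x`
  -- inherits the bounds from `b`.
  Deletion : ℕ → Word n → Word n → Set
  Deletion {n} x a b =
    Σ[ c ∈ Word n ] (suc (#e c) ≡ #e a × #e b ≤ #e c × Below u c ×
      (∀ z → EastAt z c ⇔ (EastAt z a × z ≢ x)))

  -- Scanning from the left, the path of a without x stays admissible as long as it is not below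
  -- the path of b; where it first drops below, the letter of b is an 𝐞 that can be exchanged for x.
  exchangeOrDelete : ∀ {x} (a b : Word n) → Below u a → Below u b → EastAt x a → ¬ EastAt x b →
    Exchange x a b ⊎ Deletion x a b
  exchangeOrDelete (𝐞 ∷ a) (𝐞 ∷ b) _ _ here x∉b = contradiction here x∉b
  exchangeOrDelete {suc n} (𝐞 ∷ a) (𝐧 ∷ b) (le ∷ ba) (le′ ∷ _) here _ with #e b ≤? #e a
  ... | yes b≤a = inj₂ (𝐧 ∷ a , refl , b≤a , ℕ.≤-trans le′ b≤a ∷ ba ,
    λ z → mk⇔ (λ { (there p) → there p , eastAt-≢ p })
              (λ { (here , z≢) → contradiction refl z≢ ; (there p , _) → there p }))
  -- Dropping `x` falls below `b` at once. The prefix of `a` then has fewer 𝐞's than that of `b`,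
  -- and augmenting it supplies a `y` to the left of `x`.
  ... | no b≰a with augment a b ba (ℕ.≰⇒> b≰a)
  ... | y , y∈b , y∉a , c , e≡ , below , iff = inj₁
    (y , there y∈b , (λ { here → eastAt-≢ y∈b refl ; (there p) → y∉a p }) ,
     𝐧 ∷ c , e≡ , ℕ.≤-trans le (ℕ.≤-reflexive (sym e≡)) ∷ below ,
     λ z → mk⇔ (λ { (there p) → [ (λ q → inj₁ (there q , eastAt-≢ q)) , inj₂ ]′ (to (iff z) p) })
               (λ { (inj₁ (here , z≢)) → contradiction refl z≢
                  ; (inj₁ (there p , _)) → there (from (iff z) (inj₁ p))
                  ; (inj₂ eq) → there (from (iff z) (inj₂ eq)) }))
  exchangeOrDelete {suc n} {x} (s ∷ a) (t ∷ b) (le ∷ ba) (le′ ∷ bb) (there x∈a) x∉b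
    with exchangeOrDelete a b ba bb x∈a (x∉b ∘ there)
  ... | inj₁ (y , y∈b , y∉a , c , e≡ , below , iff) = inj₁
    (y , there y∈b , (λ { here → eastAt-≢ y∈b refl ; (there p) → y∉a p }) ,
     s ∷ c , #e-cong s e≡ , ℕ.≤-trans le (ℕ.≤-reflexive (sym (#e-cong s e≡))) ∷ below ,
     λ z → mk⇔ (λ { here → inj₁ (here , eastAt-≢ x∈a ∘ sym)
                  ; (there p) → [ (λ (q , z≢) → inj₁ (there q , z≢)) , inj₂ ]′ (to (iff z) p) })
               (λ { (inj₁ (here , _)) → here
                  ; (inj₁ (there p , z≢)) → there (from (iff z) (inj₁ (p , z≢)))
                  ; (inj₂ eq) → there (from (iff z) (inj₂ eq)) }))
  ... | inj₂ (c , e≡ , b≤c , below , iff) = letters s t le le′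
    where
    delete : ∀ s t → u (suc n) ≤ #e (t ∷ b) → #e (t ∷ b) ≤ #e (s ∷ c) → Deletion x (s ∷ a) (t ∷ b)
    delete s t le′ b≤c = s ∷ c , #e-suc s e≡ , b≤c , ℕ.≤-trans le′ b≤c ∷ below ,
      λ z → mk⇔ (λ { here → here , eastAt-≢ x∈a ∘ sym
                   ; (there p) → let q , z≢ = to (iff z) p in there q , z≢ })
                (λ { (here , _) → here ; (there p , z≢) → there (from (iff z) (p , z≢)) })
    letters : ∀ s t → u (suc n) ≤ #e (s ∷ a) → u (suc n) ≤ #e (t ∷ b) →
      Exchange x (s ∷ a) (t ∷ b) ⊎ Deletion x (s ∷ a) (t ∷ b)
    letters 𝐧 𝐧 _ le′ = inj₂ (delete 𝐧 𝐧 le′ b≤c)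
    letters 𝐞 𝐧 _ le′ = inj₂ (delete 𝐞 𝐧 le′ (ℕ.m≤n⇒m≤1+n b≤c))
    letters 𝐞 𝐞 _ le′ = inj₂ (delete 𝐞 𝐞 le′ (s≤s b≤c))
    -- The 𝐞 of `b` enters here to the right of `x`. It restores the count of `a`, so the bound at
    -- this length comes from `a`.
    letters 𝐧 𝐞 le _ = inj₁
      (suc n , here , (λ { (there p) → eastAt-≢ p refl }) ,
       𝐞 ∷ c , e≡ , ℕ.≤-trans le (ℕ.≤-reflexive (sym e≡)) ∷ below ,
       λ z → mk⇔ (λ { here → inj₂ refl ; (there p) → let q , z≢ = to (iff z) p in inj₁ (there q , z≢) })
                 (λ { (inj₁ (there p , z≢)) → there (from (iff z) (p , z≢)) ; (inj₂ refl) → here }))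

  exchange : ∀ {x} (a b : Word n) → #e a ≡ #e b → Below u a → Below u b → EastAt x a → ¬ EastAt x b →
    Exchange x a b
  exchange a b e≡ ba bb x∈a x∉b with exchangeOrDelete a b ba bb x∈a x∉b
  ... | inj₁ ex = ex
  ... | inj₂ (c , c≡ , b≤c , _) =
    contradiction (ℕ.≤-trans (ℕ.≤-reflexive (trans c≡ e≡)) b≤c) (ℕ.<-irrefl refl)

-- Slicing the path matroids at the last position

agree-snoc : ∀ {xs} → AgreeOn (range n) (xs ++ [ suc n ]) xs
agree-snoc {xs = xs} x∈ = mk⇔
  (λ p → [ (λ q → q) , (λ eq → contradiction (range-≤ x∈) (ℕ.<⇒≱ (ℕ.≤-reflexive (sym eq)))) ]′ (∈-snoc⁻ xs p))
  ∈-++⁺ˡ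

InInitial-range⁺ : ∀ {n P τ} → InInitial (range n ++ [ suc n ]) P τ → InInitial (range (suc n)) P τ
InInitial-range⁺ {n} {P} {τ} = subst (λ E → InInitial E P τ) (range-snoc n)

InInitial-range⁻ : ∀ {n P τ} → InInitial (range (suc n)) P τ → InInitial (range n ++ [ suc n ]) P τ
InInitial-range⁻ {n} {P} {τ} = subst (λ E → InInitial E P τ) (sym (range-snoc n))

-- For L = L^tr, u k = #𝐞 in the first k letters of U and j = 0 these are the bases of M[U,L^tr];
-- n and j vary since deleting a last 𝐧 decreases n, contracting a last 𝐞 also increases j.
module Schubert (u : ℕ → ℕ) (d : ℕ) where

  Admissible : ℕ → Word n → Set
  Admissible j r = j + #e r ≡ d × Below u r

  Bases : ℕ → ℕ → BasisPred
  Bases n j B = Σ[ r ∈ Word n ] (Admissible j r × positions r ≡ B)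

  isMatroid : ∀ {n j P} → (∀ B → P B ⇔ Bases n j B) → (r : Word n) → Admissible j r →
    IsMatroid (range n) P
  isMatroid {n} {j} {P} P⇔ r adm = record
    { ground-strict = strict-range n
    ; basis-strict  = λ B pB → strict (to (P⇔ B) pB)
    ; basis-sub     = λ B pB → sub (to (P⇔ B) pB)
    ; basis-exists  = positions r , from (P⇔ _) (r , adm , refl)
    ; exchange      = λ B₁ B₂ p₁ p₂ x → exch (to (P⇔ B₁) p₁) (to (P⇔ B₂) p₂) x
    }
    where
    strict : ∀ {B} → Bases n j B → Strict B
    strict (a , _ , refl) = positions-strict a
    sub : ∀ {B} → Bases n j B → B ⊆ range n
    sub (a , _ , refl) = positions-⊆ a
    exch : ∀ {B₁ B₂} → Bases n j B₁ → Bases n j B₂ → ∀ x → x ∈ B₁ → x ∉ B₂ →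
      Σ[ y ∈ ℕ ] (y ∈ B₂ × y ∉ B₁ × Σ[ B₃ ∈ List ℕ ] (P B₃ ×
        (∀ z → (z ∈ B₃) ⇔ ((z ∈ B₁ × z ≢ x) ⊎ z ≡ y))))
    exch (a , (ea , ba) , refl) (b , (eb , bb) , refl) x x∈a x∉b
      with exchange u a b (ℕ.+-cancelˡ-≡ j _ _ (trans ea (sym eb))) ba bb (∈⇒eastAt a x∈a) (x∉b ∘ eastAt⇒∈)
    ... | y , y∈b , y∉a , c , ec , bc , iff =
      y , eastAt⇒∈ y∈b , y∉a ∘ ∈⇒eastAt a , positions c ,
      from (P⇔ _) (c , (trans (cong (j +_) ec) ea , bc) , refl) ,
      λ z → mk⇔ (λ p → [ (λ (q , z≢) → inj₁ (eastAt⇒∈ q , z≢)) , inj₂ ]′ (to (iff z) (∈⇒eastAt c p)))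
                (λ { (inj₁ (p , z≢)) → eastAt⇒∈ (from (iff z) (inj₁ (∈⇒eastAt a p , z≢)))
                   ; (inj₂ eq) → eastAt⇒∈ (from (iff z) (inj₂ eq)) })

  -- All words in `Bases n j` have `d - j` letters 𝐞, so the bound at full length is a condition on
  -- `n` and `j` alone. If it fails there are no bases; if it holds, the slices of `Bases (suc n) j`
  -- are all of `Bases n j` and `Bases n (suc j)`.
  Feasible : ℕ → ℕ → Set
  Feasible n j = j + u n ≤ d

  feasible : ∀ {j} {r : Word (suc n)} → Admissible j r → Feasible (suc n) j
  feasible {j = j} (refl , le ∷ _) = ℕ.+-monoʳ-≤ j le

  north⁺ : ∀ {j} {r : Word n} → Feasible (suc n) j → Admissible j r → Admissible j (𝐧 ∷ r)
  north⁺ {j = j} f (refl , b) = refl , ℕ.+-cancelˡ-≤ j _ _ f ∷ b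

  north⁻ : ∀ {j} {r : Word n} → Admissible j (𝐧 ∷ r) → Admissible j r
  north⁻ (eq , _ ∷ b) = eq , b

  east⁺ : ∀ {j} {r : Word n} → Feasible (suc n) j → Admissible (suc j) r → Admissible j (𝐞 ∷ r)
  east⁺ {j = j} {r} f (refl , b) =
    ℕ.+-suc j (#e r) , ℕ.+-cancelˡ-≤ j _ _ (ℕ.≤-trans f (ℕ.≤-reflexive (sym (ℕ.+-suc j (#e r))))) ∷ b

  east⁻ : ∀ {j} {r : Word n} → Admissible j (𝐞 ∷ r) → Admissible (suc j) r
  east⁻ {j = j} {r} (eq , _ ∷ b) = trans (sym (ℕ.+-suc j (#e r))) eq , b

  -- The 𝐞 gained by flipping stands in for the contracted one: a word for the contraction slice
  -- becomes a word for the deletion slice.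
  flip-admissible : ∀ {j} {r r′ : Word n} → #e r′ ≡ suc (#e r) → Below u r′ →
    Admissible (suc j) r → Admissible j r′
  flip-admissible {j = j} {r} e≡ b (eq , _) = trans (cong (j +_) e≡) (trans (ℕ.+-suc j (#e r)) eq) , b

  Bases-∉⁺ : ∀ {n j B} → Feasible (suc n) j → Bases n j B → Bases (suc n) j B × suc n ∉ B
  Bases-∉⁺ f (r , adm , refl) = (𝐧 ∷ r , north⁺ f adm , refl) , positions-∉ r

  Bases-∉⁻ : ∀ {n j B} → Bases (suc n) j B → suc n ∉ B → Bases n j B
  Bases-∉⁻ (𝐧 ∷ r , adm , refl) _ = r , north⁻ adm , refl
  Bases-∉⁻ (𝐞 ∷ r , _   , refl) m∉ = contradiction (∈-snoc-last (positions r)) m∉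

  Bases-∈⁺ : ∀ {n j B} → Feasible (suc n) j → Bases n (suc j) B → Bases (suc n) j (B ++ [ suc n ])
  Bases-∈⁺ f (r , adm , refl) = 𝐞 ∷ r , east⁺ f adm , refl

  Bases-∈⁻ : ∀ {n j B} → Bases (suc n) j B → suc n ∈ B →
    ∃[ B′ ] (Bases n (suc j) B′ × B ≡ B′ ++ [ suc n ] × suc n ∉ B′)
  Bases-∈⁻ (𝐞 ∷ r , adm , refl) _  = positions r , (r , east⁻ adm , refl) , refl , positions-∉ r
  Bases-∈⁻ (𝐧 ∷ r , _   , refl) m∈ = contradiction m∈ (positions-∉ r)

  module _ {n j : ℕ} {τ σ : List ℕ} (agree : AgreeOn (range n) τ σ) where

    deletion⁺ : Feasible (suc n) j →
      InInitial (range n) (λ B → Bases (suc n) j B × suc n ∉ B) τ → InInitial (range n) (Bases n j) σ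
    deletion⁺ f = InInitial-transfer (range n) (λ B b → B , Bases-∉⁺ f b , agree-refl) agree

    deletion⁻ : InInitial (range n) (Bases n j) τ →
      InInitial (range n) (λ B → Bases (suc n) j B × suc n ∉ B) σ
    deletion⁻ = InInitial-transfer (range n) (λ B (b , m∉) → B , Bases-∉⁻ b m∉ , agree-refl) agree

    contraction⁺ : Feasible (suc n) j →
      InInitial (range n) (λ B → Bases (suc n) j B × suc n ∈ B) τ → InInitial (range n) (Bases n (suc j)) σ
    contraction⁺ f = InInitial-transfer (range n)
      (λ B b → B ++ [ suc n ] , (Bases-∈⁺ f b , ∈-snoc-last B) , agree-snoc) agree

    contraction⁻ : InInitial (range n) (Bases n (suc j)) τ →
      InInitial (range n) (λ B → Bases (suc n) j B × suc n ∈ B) σ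
    contraction⁻ = InInitial-transfer (range n) pts agree
      where
      pts : ∀ B → Bases (suc n) j B × suc n ∈ B → ∃[ B′ ] (Bases n (suc j) B′ × AgreeOn (range n) B′ B)
      pts B (b , m∈) with Bases-∈⁻ b m∈
      ... | B′ , b′ , refl , _ = B′ , b′ , agree-sym agree-snoc

  -- If the last position is not in the set, the slice of the word itself suffices. If the final 𝐞
  -- is unmarked, both slices must be treated: the shortened word serves the contraction, and its
  -- flip, with the same set, the deletion.
  unmarked-standard : ∀ j (r : Word n) → Admissible j r → ¬ InInitial (range n) (Bases n j) (unmarked r)
  -- In no variables nothing is lex-smaller than 1, so the polynomial is a nonzero constant, which
  -- does not vanish at the one point.
  unmarked-standard j [] adm (c , [] , [] , c≢0 , _ , van , _) =
    c≢0 (trans (sym (trans (ℚ.+-identityʳ (c ℚ.* 1ℚ)) (ℚ.*-identityʳ c))) (van [] ([] , adm , refl)))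
  unmarked-standard j [] adm (c , [] , (_ , []) ∷ _ , c≢0 , () ∷ _ , _)
  unmarked-standard {suc n} j (𝐧 ∷ r) adm I = unmarked-standard j r (north⁻ adm)
    (deletion⁺ agree-refl (feasible adm)
      (proj₁ (InInitial-snoc-∉⁻ (range n) (unmarked-∉ r) (InInitial-range⁻ I))))
  unmarked-standard {suc n} j (𝐞 ∷ r) adm I with height r in ht
  ... | zero  = unmarked-standard (suc j) r (east⁻ adm)
    (contraction⁺ agree-refl (feasible adm)
      (proj₂ (InInitial-snoc-∉⁻ (range n) (unmarked-∉ r) (InInitial-range⁻ I))))
  ... | suc _ with flip r ht
  ... | r′ , e≡ , u≡ , _ , below = InInitial-snoc-∈⁻ (range n) (∈-snoc-last (unmarked r)) (InInitial-range⁻ I)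
    (λ I₀ → unmarked-standard j r′ (flip-admissible e≡ (below (proj₂ (east⁻ adm))) (east⁻ adm))
      (subst (InInitial (range n) (Bases n j)) (sym u≡) (deletion⁺ agree-snoc (feasible adm) I₀)))
    (λ I₁ → unmarked-standard (suc j) r (east⁻ adm) (contraction⁺ agree-snoc (feasible adm) I₁))

  -- The results for the two slices are either polynomials, which lift to a witness for `τ`, or
  -- words, which extend by a last letter. This is the converse of `unmarked-standard` in a form
  -- that avoids double negation.
  initialOrUnmarked : ∀ n j τ → Strict τ → τ ⊆ range n →
    InInitial (range n) (Bases n j) τ ⊎ (Σ[ r ∈ Word n ] (Admissible j r × unmarked r ≡ τ))
  initialOrUnmarked zero j τ s τ⊆ with j + 0 ℕ.≟ d
  ... | yes eq = inj₂ ([] , (eq , []) , sym (⊆[]⇒≡[] τ⊆))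
  ... | no neq = inj₁ (InInitial-vacuous {τ = τ} λ { B ([] , (eq , _) , _) → neq eq })
  initialOrUnmarked (suc n) j τ s τ⊆ with j + u (suc n) ≤? d
  ... | no ¬f = inj₁ (InInitial-vacuous λ B (_ , adm , _) → ¬f (feasible adm))
  ... | yes f with lastView s τ⊆
  ... | inside τ⊆′ m∉ with initialOrUnmarked n j τ s τ⊆′ | initialOrUnmarked n (suc j) τ s τ⊆′
  ... | inj₂ (r , adm , u≡) | _ = inj₂ (𝐧 ∷ r , north⁺ f adm , u≡)
  ... | inj₁ I₀ | inj₁ I₁ = inj₁ (InInitial-range⁺ (InInitial-snoc-∉⁺ (range n) m∉
          (deletion⁻ agree-refl I₀) (contraction⁻ agree-refl I₁)))
  ... | inj₁ I₀ | inj₂ (r , adm , u≡) with height r in ht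
  ... | zero  = inj₂ (𝐞 ∷ r , east⁺ f adm , trans (cong (λ h → unmarkedAt (suc n) h (unmarked r)) ht) u≡)
  -- An 𝐞 appended at positive height would be unmarked and put `suc n` into the set. The flipped
  -- word has the same set and takes an 𝐧 instead.
  ... | suc h with flip r ht
  ... | r′ , e≡ , u≡′ , _ , below =
    inj₂ (𝐧 ∷ r′ , north⁺ f (flip-admissible e≡ (below (proj₂ adm)) adm) , trans u≡′ u≡)
  initialOrUnmarked (suc n) j _ s τ⊆ | yes f | snoc σ sσ σ⊆ m∉
    with initialOrUnmarked n j σ sσ σ⊆ | initialOrUnmarked n (suc j) σ sσ σ⊆
  ... | inj₁ I₀ | _ = inj₁ (InInitial-range⁺ (InInitial-snoc-∈⁺ (range n) (∈-snoc-last σ)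
          (inj₁ (deletion⁻ (agree-sym agree-snoc) I₀))))
  ... | inj₂ _ | inj₁ I₁ = inj₁ (InInitial-range⁺ (InInitial-snoc-∈⁺ (range n) (∈-snoc-last σ)
          (inj₂ (contraction⁻ (agree-sym agree-snoc) I₁))))
  -- `r₀` has one 𝐞 more than `r₁` and the same set, so `r₁` has positive height and the appended 𝐞
  -- is unmarked.
  ... | inj₂ (r₀ , adm₀ , u≡₀) | inj₂ (r₁ , adm₁ , u≡₁) = inj₂ (𝐞 ∷ r₁ , east⁺ f adm₁ ,
    trans (cong (λ h → unmarkedAt (suc n) h (unmarked r₁))
      (height-east r₁ r₀ (ℕ.+-cancelˡ-≡ j _ _ (trans (proj₁ adm₀) (trans (sym (proj₁ adm₁)) (sym (ℕ.+-suc j (#e r₁))))))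
        (trans u≡₁ (sym u≡₀))))
      (cong (_++ [ suc n ]) u≡₁))

  Slex⇔unmarked : ∀ {n j τ} → Slex (range n) (Bases n j) τ ⇔ (Σ[ r ∈ Word n ] (Admissible j r × unmarked r ≡ τ))
  Slex⇔unmarked {n} {j} {τ} = mk⇔
    (λ (s , τ⊆ , ¬I) → [ (λ I → contradiction I ¬I) , (λ r → r) ]′ (initialOrUnmarked n j τ s τ⊆))
    (λ { (r , adm , refl) → unmarked-strict r , unmarked-⊆range r , unmarked-standard j r adm })

  -- `Del` and `Con` produce predicates that are only equivalent to some `Bases n j`, and nothing
  -- says that `Λ` respects equivalence of predicates. The induction therefore runs over all `P`
  -- equivalent to `Bases n j`.
  Λ≡unmarked : ∀ {Λ} → IsLambdaFamily Λ → ∀ {n j P} → (∀ B → P B ⇔ Bases n j B) →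
    (r : Word n) → Admissible j r → Λ (range n) P (positions r) ≡ unmarked r
  Λ≡unmarked {Λ} fam {P = P} P⇔ [] adm =
    ⊆[]⇒≡[] (proj₁ (fam [] P (isMatroid P⇔ [] adm)) [] (from (P⇔ []) ([] , adm , refl)))
  Λ≡unmarked {Λ} fam {suc n} {j} {P} P⇔ (s ∷ r) adm = byLetter s r adm
    where
    conditions = fam (range (suc n)) P (isMatroid P⇔ (s ∷ r) adm)
    standard = proj₁ (proj₂ conditions)
    injective = proj₁ (proj₂ (proj₂ conditions))
    recursion = proj₂ (proj₂ (proj₂ (proj₂ conditions))) (range n) (suc n) (sym (range-snoc n))
    f = feasible adm

    byNorth : (r : Word n) → Admissible j (𝐧 ∷ r) → Λ (range (suc n)) P (positions r) ≡ unmarked r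
    byNorth r adm = trans (proj₁ (recursion (positions r) p) (positions-∉ r))
                          (Λ≡unmarked fam Del⇔ r (north⁻ adm))
      where
      p = from (P⇔ (positions r)) (𝐧 ∷ r , adm , refl)
      ¬coloop : ¬ IsColoop P (suc n)
      ¬coloop coloop = positions-∉ r (coloop (positions r) p)
      Del⇔ : ∀ B → Del P (suc n) B ⇔ Bases n j B
      Del⇔ B = mk⇔
        (λ { (inj₁ (_ , pB , m∉)) → Bases-∉⁻ (to (P⇔ B) pB) m∉ ; (inj₂ (coloop , _)) → contradiction coloop ¬coloop })
        (λ b → let b′ , m∉ = Bases-∉⁺ f b in inj₁ (¬coloop , from (P⇔ B) b′ , m∉))

    byEast : (r : Word n) → Admissible j (𝐞 ∷ r) →
      Λ (range (suc n)) P (positions (𝐞 ∷ r)) ≡ unmarked (𝐞 ∷ r)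
    byEast r adm = fromView _ refl (lastView (proj₁ slex) (proj₁ (proj₂ slex)))
      where
      B₀ = positions (𝐞 ∷ r)
      p = from (P⇔ B₀) (𝐞 ∷ r , adm , refl)
      slex = standard B₀ p
      ¬loop : ¬ IsLoop P (suc n)
      ¬loop loop = loop B₀ p (∈-snoc-last (positions r))
      Con⇔ : ∀ B → Con P (suc n) B ⇔ Bases n (suc j) B
      Con⇔ B = mk⇔ con⁻ con⁺
        where
        con⁻ : Con P (suc n) B → Bases n (suc j) B
        con⁻ (inj₁ (loop , _)) = contradiction loop ¬loop
        con⁻ (inj₂ (_ , B₁ , pB₁ , m∈ , refl)) with Bases-∈⁻ (to (P⇔ B₁) pB₁) m∈
        ... | B′ , b′ , refl , m∉ = subst (Bases n (suc j)) (sym (remove-snoc B′ m∉)) b′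
        con⁺ : Bases n (suc j) B → Con P (suc n) B
        con⁺ b@(r , _ , refl) = inj₂ (¬loop , B ++ [ suc n ] , from (P⇔ _) (Bases-∈⁺ f b) ,
          ∈-snoc-last B , sym (remove-snoc B (positions-∉ r)))
      removed : remove (suc n) (Λ (range (suc n)) P B₀) ≡ unmarked r
      removed = trans (proj₂ (recursion B₀ p) (∈-snoc-last (positions r)))
        (trans (cong (Λ (range n) (Con P (suc n))) (remove-snoc (positions r) (positions-∉ r)))
               (Λ≡unmarked fam Con⇔ r (east⁻ adm)))

      fromView : ∀ τ → Λ (range (suc n)) P B₀ ≡ τ → LastView n τ → Λ (range (suc n)) P B₀ ≡ unmarked (𝐞 ∷ r)
      fromView τ Λ≡ (inside _ m∉) = marked (height r) refl
        where
        Λ≡u : Λ (range (suc n)) P B₀ ≡ unmarked r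
        Λ≡u = trans Λ≡ (trans (sym (remove-∉ m∉)) (trans (cong (remove (suc n)) (sym Λ≡)) removed))
        marked : ∀ h → height r ≡ h → Λ (range (suc n)) P B₀ ≡ unmarkedAt (suc n) h (unmarked r)
        marked zero    _  = Λ≡u
        -- At positive height the flipped word followed by 𝐧 has the same image under `Λ`, by the
        -- case of a final 𝐧, but its basis lacks `suc n`. Injectivity rules this out.
        marked (suc h) ht with flip r ht
        ... | r′ , e≡ , u≡ , _ , below = contradiction (∈-snoc-last (positions r))
          (subst (suc n ∉_) (injective (positions r′) B₀ (from (P⇔ _) (𝐧 ∷ r′ , adm′ , refl)) p
                              (trans (byNorth r′ adm′) (trans u≡ (sym Λ≡u)))) (positions-∉ r′))
          where adm′ = north⁺ f (flip-admissible e≡ (below (proj₂ (east⁻ adm))) (east⁻ adm))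
      fromView _ Λ≡ (snoc σ _ _ m∉) = unmarked? (height r) refl
        where
        σ≡ : σ ≡ unmarked r
        σ≡ = trans (sym (remove-snoc σ m∉)) (trans (cong (remove (suc n)) (sym Λ≡)) removed)
        slex′ : Slex (range (suc n)) (Bases (suc n) j) (σ ++ [ suc n ])
        slex′ = subst (Slex _ _) Λ≡
          (proj₁ slex , proj₁ (proj₂ slex) , proj₂ (proj₂ slex) ∘ InInitial-resp (λ B → to (P⇔ B)))
        unmarked? : ∀ h → height r ≡ h → Λ (range (suc n)) P B₀ ≡ unmarkedAt (suc n) h (unmarked r)
        unmarked? (suc _) _  = trans Λ≡ (cong (_++ [ suc n ]) σ≡)
        -- The image is standard, hence the unmarked set of some word, which must end in an unmarked
        -- 𝐞. The rest of that word has as many 𝐞's and the same set as `r`, hence height zero, and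
        -- this would mark the 𝐞.
        unmarked? zero    ht with to Slex⇔unmarked slex′
        ... | 𝐧 ∷ r′ , _ , u≡ = contradiction (subst (suc n ∈_) (sym u≡) (∈-snoc-last σ)) (unmarked-∉ r′)
        ... | 𝐞 ∷ r′ , adm′ , u≡ with height r′ in ht′
        ... | zero  = contradiction (subst (suc n ∈_) (sym u≡) (∈-snoc-last σ)) (unmarked-∉ r′)
        ... | suc _ with trans (sym ht′) (trans (height-unique r′ r
                (ℕ.+-cancelˡ-≡ (suc j) _ _ (trans (proj₁ (east⁻ adm′)) (sym (proj₁ (east⁻ adm)))))
                (trans (List.∷ʳ-injectiveˡ _ _ u≡) σ≡)) ht)
        ... | ()

    byLetter : ∀ s r → Admissible j (s ∷ r) → Λ (range (suc n)) P (positions (s ∷ r)) ≡ unmarked (s ∷ r)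
    byLetter 𝐧 = byNorth
    byLetter 𝐞 = byEast

-- Words and lattice paths

length-path : (r : Word n) → length (path r) ≡ n
length-path []      = refl
length-path (s ∷ r) = trans (List.length-++-comm (path r) [ s ]) (cong suc (length-path r))

path-surjective : ∀ C → length C ≡ n → Σ[ r ∈ Word n ] path r ≡ C
path-surjective C refl with go (reverseView C)
  where
  go : ∀ {C} → Reverse C → ∃[ n ] Σ[ r ∈ Word n ] path r ≡ C
  go []              = 0 , [] , refl
  go (xs ∶ rs ∶ʳ x) with go rs
  ... | n , r , refl = suc n , x ∷ r , refl
... | n , r , refl = subst (λ k → Σ[ r′ ∈ Word k ] path r′ ≡ path r) (sym (length-path r)) (r , refl)

countE-++ : ∀ xs ys → countE (xs ++ ys) ≡ countE xs + countE ys
countE-++ []       ys = refl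
countE-++ (𝐞 ∷ xs) ys = cong suc (countE-++ xs ys)
countE-++ (𝐧 ∷ xs) ys = countE-++ xs ys

countE-path : (r : Word n) → countE (path r) ≡ #e r
countE-path []      = refl
countE-path (𝐞 ∷ r) = trans (countE-++ (path r) [ 𝐞 ]) (trans (ℕ.+-comm _ 1) (cong suc (countE-path r)))
countE-path (𝐧 ∷ r) = trans (countE-++ (path r) [ 𝐧 ]) (trans (ℕ.+-identityʳ _) (countE-path r))

posE-++ : ∀ i xs ys → posE i (xs ++ ys) ≡ posE i xs ++ posE (i + length xs) ys
posE-++ i []       ys = cong (λ k → posE k ys) (sym (ℕ.+-identityʳ i))
posE-++ i (𝐞 ∷ xs) ys = cong (i ∷_) (trans (posE-++ (suc i) xs ys)
  (cong (λ k → posE (suc i) xs ++ posE k ys) (sym (ℕ.+-suc i (length xs)))))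
posE-++ i (𝐧 ∷ xs) ys = trans (posE-++ (suc i) xs ys)
  (cong (λ k → posE (suc i) xs ++ posE k ys) (sym (ℕ.+-suc i (length xs))))

EC-path : (r : Word n) → EC (path r) ≡ positions r
EC-path []      = refl
EC-path (𝐞 ∷ r) = trans (posE-++ 1 (path r) [ 𝐞 ])
  (cong₂ (λ B k → B ++ [ suc k ]) (EC-path r) (length-path r))
EC-path (𝐧 ∷ r) = trans (posE-++ 1 (path r) [ 𝐧 ]) (trans (List.++-identityʳ _) (EC-path r))

countN : List Step → ℕ
countN []      = 0
countN (𝐞 ∷ s) = countN s
countN (𝐧 ∷ s) = suc (countN s)

-- The state in which the scan reaches `ys` can be read off from `xs` and its output: the number of
-- unmarked 𝐞's has grown by the length of that output.
stGo-++ : ∀ i nn ue xs ys → stGo i nn ue (xs ++ ys) ≡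
  stGo i nn ue xs ++ stGo (i + length xs) (nn + countN xs) (ue + length (stGo i nn ue xs)) ys
stGo-++ i nn ue [] ys rewrite ℕ.+-identityʳ i | ℕ.+-identityʳ nn | ℕ.+-identityʳ ue = refl
stGo-++ i nn ue (𝐧 ∷ xs) ys
  rewrite ℕ.+-suc i (length xs) | ℕ.+-suc nn (countN xs) = stGo-++ (suc i) (suc nn) ue xs ys
stGo-++ i nn ue (𝐞 ∷ xs) ys with nn ℕ.≟ ue
... | yes _ rewrite ℕ.+-suc i (length xs) = stGo-++ (suc i) nn ue xs ys
... | no  _ rewrite ℕ.+-suc i (length xs) | ℕ.+-suc ue (length (stGo (suc i) nn (suc ue) xs)) =
  cong (i ∷_) (stGo-++ (suc i) nn (suc ue) xs ys)

countN-++ : ∀ xs ys → countN (xs ++ ys) ≡ countN xs + countN ys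
countN-++ []       ys = refl
countN-++ (𝐞 ∷ xs) ys = countN-++ xs ys
countN-++ (𝐧 ∷ xs) ys = cong suc (countN-++ xs ys)

countN-path : (r : Word n) → countN (path r) ≡ height r + length (unmarked r)
countN-path []      = refl
countN-path (𝐧 ∷ r) = trans (countN-++ (path r) [ 𝐧 ]) (trans (ℕ.+-comm _ 1) (cong suc (countN-path r)))
countN-path {suc n} (𝐞 ∷ r) with height r | countN-path r
... | zero  | eq = trans (countN-++ (path r) [ 𝐞 ]) (trans (ℕ.+-identityʳ _) eq)
... | suc h | eq = trans (countN-++ (path r) [ 𝐞 ]) (trans (ℕ.+-identityʳ _) (trans eq
  (sym (trans (cong (h +_) (List.length-++-comm (unmarked r) [ suc n ])) (ℕ.+-suc h _)))))

stGo-east : ∀ m {nn ue} h τ → nn ≡ h + ue → τ ++ stGo m nn ue [ 𝐞 ] ≡ unmarkedAt m h τ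
stGo-east m {nn} {ue} zero    τ eq with nn ℕ.≟ ue
... | yes _  = List.++-identityʳ τ
... | no neq = contradiction eq neq
stGo-east m {nn} {ue} (suc h) τ eq with nn ℕ.≟ ue
... | yes eq′ = contradiction (trans (sym eq′) eq) (ℕ.m≢1+n+m ue)
... | no _    = refl

st-path : (r : Word n) → st (path r) ≡ unmarked r
st-path []      = refl
st-path (𝐧 ∷ r) = trans (stGo-++ 1 0 0 (path r) [ 𝐧 ]) (trans (List.++-identityʳ _) (st-path r))
st-path (𝐞 ∷ r) = trans (stGo-++ 1 0 0 (path r) [ 𝐞 ])
  (trans (cong₂ (λ τ k → τ ++ stGo (suc k) (countN (path r)) (length τ) [ 𝐞 ]) (st-path r) (length-path r))
         (stGo-east _ (height r) (unmarked r) (countN-path r)))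

take-++-≤ : ∀ k (xs ys : List Step) → k ≤ length xs → take k (xs ++ ys) ≡ take k xs
take-++-≤ zero    xs       ys _        = refl
take-++-≤ (suc k) (x ∷ xs) ys (s≤s le) = cong (x ∷_) (take-++-≤ k xs ys le)

take-path : ∀ s (r : Word n) {k} → k ≤ n → take k (path (s ∷ r)) ≡ take k (path r)
take-path s r {k} k≤n = take-++-≤ k (path r) [ s ] (ℕ.≤-trans k≤n (ℕ.≤-reflexive (sym (length-path r))))

take-path-all : (r : Word n) → ∀ {k} → n ≤ k → take k (path r) ≡ path r
take-path-all r {k} n≤k = List.take-all k (path r) (ℕ.≤-trans (ℕ.≤-reflexive (length-path r)) n≤k)

module _ {u : ℕ → ℕ} (u0 : u 0 ≤ 0) where

  -- The empty prefix, on which `Below` is silent, is covered by `u0`.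
  below-prefix : (r : Word n) → Below u r → ∀ k → k ≤ n → u k ≤ countE (take k (path r))
  below-prefix []      []       zero _ = u0
  below-prefix {suc n} (s ∷ r) (le ∷ b) k k≤ with ℕ.m≤n⇒m<n∨m≡n k≤
  ... | inj₁ (s≤s k≤n) = subst (λ w → u k ≤ countE w) (sym (take-path s r k≤n)) (below-prefix r b k k≤n)
  ... | inj₂ refl      = ℕ.≤-trans le (ℕ.≤-reflexive (sym (trans (cong countE (take-path-all (s ∷ r) ℕ.≤-refl)) (countE-path (s ∷ r)))))

  prefix-below : (r : Word n) → (∀ k → k ≤ n → u k ≤ countE (take k (path r))) → Below u r
  prefix-below []      _ = []
  prefix-below {suc n} (s ∷ r) h =
    ℕ.≤-trans (h (suc n) ℕ.≤-refl) (ℕ.≤-reflexive (trans (cong countE (take-path-all (s ∷ r) ℕ.≤-refl)) (countE-path (s ∷ r))))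
    ∷ prefix-below r (λ k k≤n → subst (λ w → u k ≤ countE w) (take-path s r k≤n) (h k (ℕ.m≤n⇒m≤1+n k≤n)))

countE-take : ∀ k C → countE (take k C) ≤ countE C
countE-take zero    C       = z≤n
countE-take (suc k) []      = z≤n
countE-take (suc k) (𝐞 ∷ C) = s≤s (countE-take k C)
countE-take (suc k) (𝐧 ∷ C) = countE-take k C

-- A prefix of length `k` has at most `k` and at most `countE C` letters 𝐞, and a word beginning
-- with `countE C` letters 𝐞 reaches the smaller of the two. The lower boundary L^tr thus imposes no
-- condition.
weaklyAbove-Ltr : ∀ C X → WeaklyAbove C (replicate (countE C) 𝐞 ++ X)
weaklyAbove-Ltr C X k = ≤-east k (countE C) (countE-≤ k C) (countE-take k C)
  where
  ≤-east : ∀ {m} k d → m ≤ k → m ≤ d → m ≤ countE (take k (replicate d 𝐞 ++ X))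
  ≤-east {zero}  k       d       _        _         = z≤n
  ≤-east {suc m} (suc k) (suc d) (s≤s le) (s≤s le′) = s≤s (≤-east k d le le′)
  countE-≤ : ∀ k C → countE (take k C) ≤ k
  countE-≤ zero    C       = z≤n
  countE-≤ (suc k) []      = z≤n
  countE-≤ (suc k) (𝐞 ∷ C) = s≤s (countE-≤ k C)
  countE-≤ (suc k) (𝐧 ∷ C) = ℕ.m≤n⇒m≤1+n (countE-≤ k C)

-- Identification with M[U,L^tr]

module _ (n d : ℕ) (U : List Step) (U∈ : InP n d U) where

  open Schubert (λ k → countE (take k U)) d

  toWord : ∀ C → InPUL n d U (Ltr n d) C → Σ[ r ∈ Word n ] (path r ≡ C × Admissible 0 r)
  toWord C ((len , e≡) , above , _) with path-surjective C len
  ... | r , refl = r , refl , trans (sym (countE-path r)) e≡ , prefix-below z≤n r (λ k _ → above k)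

  fromWord : (r : Word n) → Admissible 0 r → InPUL n d U (Ltr n d) (path r)
  fromWord r (e≡ , b) = (length-path r , countE≡d) , above ,
    subst (λ d → WeaklyAbove (path r) (Ltr n d)) countE≡d (weaklyAbove-Ltr (path r) _)
    where
    countE≡d = trans (countE-path r) e≡
    above : WeaklyAbove U (path r)
    above k with ℕ.≤-total k n
    ... | inj₁ k≤n = below-prefix z≤n r b k k≤n
    -- `WeaklyAbove` ranges over all `k`; from `n` on both prefixes are the whole words, each with
    -- `d` letters 𝐞.
    ... | inj₂ n≤k = ℕ.≤-trans (countE-take k U) (ℕ.≤-reflexive (trans (proj₂ U∈)
                       (trans (sym countE≡d) (cong countE (sym (take-path-all r n≤k))))))

  LPM⇔Bases : ∀ B → LPM n d U (Ltr n d) B ⇔ Bases n 0 B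
  LPM⇔Bases B = mk⇔ ⇒ λ { (r , adm , refl) → path r , fromWord r adm , EC-path r }
    where
    ⇒ : LPM n d U (Ltr n d) B → Bases n 0 B
    ⇒ (C , C∈ , refl) with toWord C C∈
    ... | r , refl , adm = r , adm , sym (EC-path r)

theorem4p4 : ∀ (n d : ℕ) (U : List Step) → InP n d U →
    ((Λ : LambdaFam) → IsLambdaFamily Λ →
    ∀ C → InPUL n d U (Ltr n d) C →
    st C ≡ Λ (range n) (LPM n d U (Ltr n d)) (EC C))
    ×
    (∀ τ → Slex (range n) (LPM n d U (Ltr n d)) τ
    ⇔ (Σ[ C ∈ List Step ] (InPUL n d U (Ltr n d) C × st C ≡ τ)))
theorem4p4 n d U U∈ = st≡Λ , λ τ → mk⇔ ⇒ ⇐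
  where
  open Schubert (λ k → countE (take k U)) d
  M = LPM n d U (Ltr n d)
  P⇔ = LPM⇔Bases n d U U∈

  st≡Λ : (Λ : LambdaFam) → IsLambdaFamily Λ → ∀ C → InPUL n d U (Ltr n d) C → st C ≡ Λ (range n) M (EC C)
  st≡Λ Λ fam C C∈ with toWord n d U U∈ C C∈
  ... | r , refl , adm = trans (st-path r)
    (trans (sym (Λ≡unmarked fam P⇔ r adm)) (cong (Λ (range n) M) (sym (EC-path r))))

  ⇒ : ∀ {τ} → Slex (range n) M τ → Σ[ C ∈ List Step ] (InPUL n d U (Ltr n d) C × st C ≡ τ)
  ⇒ (s , τ⊆ , ¬I) with to Slex⇔unmarked (s , τ⊆ , ¬I ∘ InInitial-resp (λ B → to (P⇔ B)))
  ... | r , adm , refl = path r , fromWord n d U U∈ r adm , st-path r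

  ⇐ : ∀ {τ} → Σ[ C ∈ List Step ] (InPUL n d U (Ltr n d) C × st C ≡ τ) → Slex (range n) M τ
  ⇐ (C , C∈ , refl) with toWord n d U U∈ C C∈
  ... | r , refl , adm with from Slex⇔unmarked (r , adm , sym (st-path r))
  ... | s , τ⊆ , ¬I = s , τ⊆ , ¬I ∘ InInitial-resp (λ B → from (P⇔ B))
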